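{- For all integers $g\ge 3$ and $k\ge 1$, there exists a finite collection $\mathcal{S}$ of straight (infinite) lines in $\mathbb{R}^3$ whose intersection graph has girth at least $g$ and chromatic number at least $k$.
   Context: The intersection graph of a collection of sets is the simple graph whose vertices are the sets of the collection, two distinct sets being adjacent if and only if they have non-empty intersection. The girth of a graph is the length of its shortest cycle ($\infty$ if the graph has no cycle). -}

module Defs where

open import Level using (0ℓ)
open import Data.Fin.Base using (Fin; zero; suc; inject₁; fromℕ)
open import Data.Nat.Base as ℕ using (ℕ)
import Data.Nat.Properties as ℕ
open import Data.Product.Base using (Σ-syntax; ∃-syntax; _×_; _,_; proj₁; proj₂)
open import Data.Rational.Base as ℚ using (ℚ; 0ℚ; 1ℚ; ∣_∣)
import Data.Rational.Properties as ℚ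
open import Data.Rational.Solver using (module +-*-Solver)
open import Data.Vec.Functional using (Vector)
open import Function.Base using (_∘_)
open import Function.Definitions using (Injective)
open import Relation.Binary.Construct.Add.Supremum.NonStrict ℕ._≤_ using (_≤⁺_) public
open import Relation.Binary.Core using (Rel)
open import Relation.Binary.Definitions using (Symmetric; Irreflexive)
open import Relation.Binary.PropositionalEquality.Core
  using (_≡_; _≢_; refl; sym; cong; subst; ≢-sym)
open import Relation.Nullary.Construct.Add.Supremum using (_⁺; [_]; ⊤⁺) public
open import Relation.Nullary.Negation.Core using (¬_)
open import Relation.Unary using (Pred; _≐_; _≬_)

-- Real numbers are Cauchy sequences of rationals, two of them being equal
-- (_≈_) when their difference tends to 0.
IsCauchy : (ℕ → ℚ) → Set
IsCauchy x = ∀ (ε : ℚ) → 0ℚ ℚ.< ε →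
  ∃[ N ] (∀ m n → N ℕ.≤ m → N ℕ.≤ n → ∣ x m ℚ.- x n ∣ ℚ.< ε)

record ℝ : Set where
  constructor mkℝ
  field
    seq    : ℕ → ℚ
    cauchy : IsCauchy seq

open ℝ public

infix 4 _≈_

_≈_ : Rel ℝ 0ℓ
x ≈ y = ∀ (ε : ℚ) → 0ℚ ℚ.< ε →
  ∃[ N ] (∀ n → N ℕ.≤ n → ∣ seq x n ℚ.- seq y n ∣ ℚ.< ε)

fromℚ : ℚ → ℝ
fromℚ q = mkℝ (λ _ → q) λ ε 0<ε →
  0 , λ _ _ _ _ → subst (ℚ._< ε) (cong ∣_∣ (sym (ℚ.+-inverseʳ q))) 0<ε

0ℝ : ℝ
0ℝ = fromℚ 0ℚ

divide : ∀ (B ε : ℚ) → 0ℚ ℚ.< B → 0ℚ ℚ.< ε →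
         ∃[ δ ] (0ℚ ℚ.< δ × B ℚ.* δ ≡ ε)
divide B ε 0<B 0<ε = δ , ℚ.positive⁻¹ δ , eq
  where
  instance
    B>0 : ℚ.Positive B
    B>0 = ℚ.positive 0<B
    ε>0 : ℚ.Positive ε
    ε>0 = ℚ.positive 0<ε
    B≠0 : ℚ.NonZero B
    B≠0 = ℚ.pos⇒nonZero B
    B⁻¹>0 : ℚ.Positive (ℚ.1/ B)
    B⁻¹>0 = ℚ.1/pos⇒pos B
  δ : ℚ
  δ = ℚ.1/ B ℚ.* ε
  instance
    δ>0 : ℚ.Positive δ
    δ>0 = ℚ.pos*pos⇒pos (ℚ.1/ B) ε
  open ℚ.≤-Reasoning
  eq : B ℚ.* δ ≡ ε
  eq = begin-equality
    B ℚ.* (ℚ.1/ B ℚ.* ε)  ≡⟨ ℚ.*-assoc B (ℚ.1/ B) ε ⟨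
    B ℚ.* ℚ.1/ B ℚ.* ε    ≡⟨ cong (ℚ._* ε) (ℚ.*-inverseʳ B) ⟩
    1ℚ ℚ.* ε              ≡⟨ ℚ.*-identityˡ ε ⟩
    ε                     ∎

eventuallyBounded : ∀ (x : ℝ) → ∃[ N ] ∃[ B ]
  (0ℚ ℚ.< B × (∀ n → N ℕ.≤ n → ∣ seq x n ∣ ℚ.≤ B))
eventuallyBounded (mkℝ x cx) = N , 1ℚ ℚ.+ ∣ x N ∣ , 0<B , bound
  where
  N : ℕ
  N = proj₁ (cx 1ℚ (ℚ.positive⁻¹ 1ℚ))
  0<B : 0ℚ ℚ.< 1ℚ ℚ.+ ∣ x N ∣
  0<B = ℚ.+-mono-<-≤ (ℚ.positive⁻¹ 1ℚ) (ℚ.0≤∣p∣ (x N))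
  open ℚ.≤-Reasoning
  split : ∀ a b → a ≡ (a ℚ.- b) ℚ.+ b
  split = solve 2 (λ a b → a := (a :- b) :+ b) refl
    where open +-*-Solver
  bound : ∀ n → N ℕ.≤ n → ∣ x n ∣ ℚ.≤ 1ℚ ℚ.+ ∣ x N ∣
  bound n N≤n = begin
    ∣ x n ∣                     ≡⟨ cong ∣_∣ (split (x n) (x N)) ⟩
    ∣ (x n ℚ.- x N) ℚ.+ x N ∣   ≤⟨ ℚ.∣p+q∣≤∣p∣+∣q∣ (x n ℚ.- x N) (x N) ⟩
    ∣ x n ℚ.- x N ∣ ℚ.+ ∣ x N ∣ ≤⟨ ℚ.+-monoˡ-≤ ∣ x N ∣ (ℚ.<⇒≤ near) ⟩
    1ℚ ℚ.+ ∣ x N ∣              ∎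
    where
    near : ∣ x n ℚ.- x N ∣ ℚ.< 1ℚ
    near = proj₂ (cx 1ℚ (ℚ.positive⁻¹ 1ℚ)) n N N≤n ℕ.≤-refl

+-cauchy : ∀ (x y : ℝ) → IsCauchy (λ n → seq x n ℚ.+ seq y n)
+-cauchy (mkℝ x cx) (mkℝ y cy) ε 0<ε =
  let δ , 0<δ , 2δ≡ε = divide (1ℚ ℚ.+ 1ℚ) ε (ℚ.positive⁻¹ (1ℚ ℚ.+ 1ℚ)) 0<ε
      M , hx = cx δ 0<δ
      N , hy = cy δ 0<δ
  in M ℕ.⊔ N , λ m n m≥ n≥ → begin-strict
    ∣ (x m ℚ.+ y m) ℚ.- (x n ℚ.+ y n) ∣   ≡⟨ cong ∣_∣ (split (x m) (y m) (x n) (y n)) ⟩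
    ∣ (x m ℚ.- x n) ℚ.+ (y m ℚ.- y n) ∣   ≤⟨ ℚ.∣p+q∣≤∣p∣+∣q∣ (x m ℚ.- x n) (y m ℚ.- y n) ⟩
    ∣ x m ℚ.- x n ∣ ℚ.+ ∣ y m ℚ.- y n ∣   <⟨ ℚ.+-mono-<
      (hx m n (ℕ.m⊔n≤o⇒m≤o M N m≥) (ℕ.m⊔n≤o⇒m≤o M N n≥))
      (hy m n (ℕ.m⊔n≤o⇒n≤o M N m≥) (ℕ.m⊔n≤o⇒n≤o M N n≥)) ⟩
    δ ℚ.+ δ                               ≡⟨ double δ ⟩
    (1ℚ ℚ.+ 1ℚ) ℚ.* δ                     ≡⟨ 2δ≡ε ⟩
    ε                                     ∎
  where
  open ℚ.≤-Reasoning
  open +-*-Solver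
  split : ∀ a b c d → (a ℚ.+ b) ℚ.- (c ℚ.+ d) ≡ (a ℚ.- c) ℚ.+ (b ℚ.- d)
  split = solve 4 (λ a b c d → (a :+ b) :- (c :+ d) := (a :- c) :+ (b :- d)) refl
  double : ∀ a → a ℚ.+ a ≡ (1ℚ ℚ.+ 1ℚ) ℚ.* a
  double = solve 1 (λ a → a :+ a := (con 1ℚ :+ con 1ℚ) :* a) refl

*-cauchy : ∀ (x y : ℝ) → IsCauchy (λ n → seq x n ℚ.* seq y n)
*-cauchy x′@(mkℝ x cx) y′@(mkℝ y cy) ε 0<ε =
  let M , B , 0<B , bx = eventuallyBounded x′
      N , C , 0<C , by = eventuallyBounded y′
      δ , 0<δ , eq = divide (B ℚ.+ C) ε (ℚ.+-mono-< 0<B 0<C) 0<ε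
      M′ , hx = cx δ 0<δ
      N′ , hy = cy δ 0<δ
      P = M ℕ.⊔ N
      P′ = M′ ℕ.⊔ N′
      K = P ℕ.⊔ P′
      K≥M  : ∀ {m} → K ℕ.≤ m → M ℕ.≤ m
      K≥M  = λ h → ℕ.m⊔n≤o⇒m≤o M N (ℕ.m⊔n≤o⇒m≤o P P′ h)
      K≥N  : ∀ {m} → K ℕ.≤ m → N ℕ.≤ m
      K≥N  = λ h → ℕ.m⊔n≤o⇒n≤o M N (ℕ.m⊔n≤o⇒m≤o P P′ h)
      K≥M′ : ∀ {m} → K ℕ.≤ m → M′ ℕ.≤ m
      K≥M′ = λ h → ℕ.m⊔n≤o⇒m≤o M′ N′ (ℕ.m⊔n≤o⇒n≤o P P′ h)
      K≥N′ : ∀ {m} → K ℕ.≤ m → N′ ℕ.≤ m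
      K≥N′ = λ h → ℕ.m⊔n≤o⇒n≤o M′ N′ (ℕ.m⊔n≤o⇒n≤o P P′ h)
  in K , λ m n m≥ n≥ → begin-strict
    ∣ x m ℚ.* y m ℚ.- x n ℚ.* y n ∣
      ≡⟨ cong ∣_∣ (split (x m) (y m) (x n) (y n)) ⟩
    ∣ x m ℚ.* (y m ℚ.- y n) ℚ.+ y n ℚ.* (x m ℚ.- x n) ∣
      ≤⟨ ℚ.∣p+q∣≤∣p∣+∣q∣ (x m ℚ.* (y m ℚ.- y n)) (y n ℚ.* (x m ℚ.- x n)) ⟩
    ∣ x m ℚ.* (y m ℚ.- y n) ∣ ℚ.+ ∣ y n ℚ.* (x m ℚ.- x n) ∣
      <⟨ ℚ.+-mono-<
           (bound (x m) (y m ℚ.- y n) 0<B (bx m (K≥M m≥)) (hy m n (K≥N′ m≥) (K≥N′ n≥)))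
           (bound (y n) (x m ℚ.- x n) 0<C (by n (K≥N n≥)) (hx m n (K≥M′ m≥) (K≥M′ n≥))) ⟩
    B ℚ.* δ ℚ.+ C ℚ.* δ
      ≡⟨ ℚ.*-distribʳ-+ δ B C ⟨
    (B ℚ.+ C) ℚ.* δ
      ≡⟨ eq ⟩
    ε ∎
  where
  open ℚ.≤-Reasoning
  split : ∀ a b c d → a ℚ.* b ℚ.- c ℚ.* d ≡ a ℚ.* (b ℚ.- d) ℚ.+ d ℚ.* (a ℚ.- c)
  split = solve 4 (λ a b c d → a :* b :- c :* d := a :* (b :- d) :+ d :* (a :- c)) refl
    where open +-*-Solver
  bound : ∀ p q {B δ} → 0ℚ ℚ.< B → ∣ p ∣ ℚ.≤ B → ∣ q ∣ ℚ.< δ → ∣ p ℚ.* q ∣ ℚ.< B ℚ.* δ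
  bound p q {B} {δ} 0<B p≤B q<δ = begin-strict
    ∣ p ℚ.* q ∣       ≡⟨ ℚ.∣p*q∣≡∣p∣*∣q∣ p q ⟩
    ∣ p ∣ ℚ.* ∣ q ∣   ≤⟨ ℚ.*-monoʳ-≤-nonNeg ∣ q ∣ {{ℚ.∣-∣-nonNeg q}} p≤B ⟩
    B ℚ.* ∣ q ∣       <⟨ ℚ.*-monoʳ-<-pos B {{ℚ.positive 0<B}} q<δ ⟩
    B ℚ.* δ           ∎

infixl 6 _+_
infixl 7 _*_

_+_ : ℝ → ℝ → ℝ
x + y = mkℝ (λ n → seq x n ℚ.+ seq y n) (+-cauchy x y)

_*_ : ℝ → ℝ → ℝ
x * y = mkℝ (λ n → seq x n ℚ.* seq y n) (*-cauchy x y)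

Point : ℕ → Set
Point d = Vector ℝ d

infix 4 _≈ₚ_

_≈ₚ_ : ∀ {d} → Rel (Point d) 0ℓ
x ≈ₚ y = ∀ i → x i ≈ y i

lineThrough : ∀ {d} → Point d → Point d → Pred (Point d) 0ℓ
lineThrough p v x = ∃[ t ] x ≈ₚ (λ i → p i + t * v i)

IsLine : ∀ {d} → Pred (Point d) 0ℓ → Set
IsLine {d} L =
  Σ[ p ∈ Point d ] Σ[ v ∈ Point d ] (¬ (v ≈ₚ λ _ → 0ℝ)) × L ≐ lineThrough p v

record SimpleGraph : Set₁ where
  field
    Vertex : Set
    Adj    : Rel Vertex 0ℓ
    symm   : Symmetric Adj
    irrefl : Irreflexive _≡_ Adj

module _ (G : SimpleGraph) where
  open SimpleGraph G

  -- A cycle v₀ v₁ … v_ℓ = v₀ with v₀, …, v_{ℓ-1} distinct and ℓ ≥ 3.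
  HasCycle : ℕ → Set
  HasCycle ℓ = 3 ℕ.≤ ℓ × Σ[ c ∈ (Fin (ℕ.suc ℓ) → Vertex) ]
    ( Injective _≡_ _≡_ (c ∘ inject₁)
    × c (fromℕ ℓ) ≡ c zero
    × (∀ i → Adj (c (inject₁ i)) (c (suc i))) )

  Colourable : ℕ → Set
  Colourable k = Σ[ f ∈ (Vertex → Fin k) ] (∀ {u v} → Adj u v → f u ≢ f v)

IsLeast : Pred ℕ 0ℓ → ℕ → Set
IsLeast P n = P n × (∀ m → P m → n ℕ.≤ m)

-- The top element ⊤⁺ of ℕ ⁺ plays the role of ∞.
IsGirth : SimpleGraph → ℕ ⁺ → Set
IsGirth G ⊤⁺    = ∀ ℓ → ¬ HasCycle G ℓ
IsGirth G [ n ] = IsLeast (HasCycle G) n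

IsChromaticNumber : SimpleGraph → ℕ → Set
IsChromaticNumber G = IsLeast (Colourable G)

record FiniteCollection (X : Set) : Set₁ where
  field
    size     : ℕ
    member   : Fin size → Pred X 0ℓ
    distinct : Injective _≡_ _≐_ member

open FiniteCollection public

-- By `distinct`, distinct indices are the same thing as distinct sets.
intersectionGraph : ∀ {X} → FiniteCollection X → SimpleGraph
intersectionGraph S = record
  { Vertex = Fin (size S)
  ; Adj    = λ i j → i ≢ j × member S i ≬ member S j
  ; symm   = λ (i≢j , x , x∈i , x∈j) → ≢-sym i≢j , x , x∈j , x∈i
  ; irrefl = λ i≡j (i≢j , _) → i≢j i≡j
  }

{-# OPTIONS --safe #-}

-- The line {(t , β + t δ)} in ℝ³ is the world line of a particle of the plane that has
-- velocity δ and is at β at time 0; two lines intersect iff their particles collide,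
-- i.e. iff δ ≢ δ′ and det (β - β′ , δ - δ′) = 0. Given n particles whose collision graph
-- has girth at least g and no proper k-colouring, the Tutte–Zykov construction yields
-- one without a proper (k + 1)-colouring. Take a sparse Hales–Jewett hypergraph: words
-- over an alphabet of n letters with a set of combinatorial lines of large girth, such
-- that every (k + 1)-colouring of the words has a monochromatic line. Place the words in
-- the plane by w ↦ Σⱼ μⱼ β(wⱼ) as resting particles; a combinatorial line becomes a
-- homothetic copy of the initial positions, so a scaled copy of the n particles can
-- move through its points, one particle through each point. Generic μ, a generic common
-- boost of the velocities and generic delays of the copies exclude all other collisions.
--
-- The sparse Hales–Jewett theorem is obtained from the plain one by the partite
-- construction of Nešetřil and Rödl, each application of which doubles the girth.
module Submission where

open import Defs renaming (_+_ to _+ʳ_; _*_ to _*ʳ_)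
open import Data.Empty using (⊥)
open import Data.Fin.Base as Fin using (Fin; zero; suc; toℕ; inject₁; fromℕ)
import Data.Fin.Properties as Fin
open import Data.Integer.Base as ℤ using (ℤ; +_; 0ℤ; 1ℤ)
import Data.Integer.Properties as ℤ
import Data.Integer.Tactic.RingSolver as ℤ
open import Data.List.Base as List using (List)
open import Data.List.Membership.Propositional using () renaming (_∈_ to _∈ˡ_)
open import Data.List.Membership.Propositional.Properties using (∈-cartesianProductWith⁺; ∈-filter⁺; ∈-filter⁻; ∈-allFin; ∈-lookup) renaming (∈-map⁺ to ∈ˡ-map⁺)
open import Data.List.Relation.Unary.Any as AnyL using () renaming (here to hereˡ; there to thereˡ)
import Data.List.Relation.Unary.Any.Properties as AnyL
open import Data.Maybe.Base as Maybe using (Maybe; just; nothing; fromMaybe; maybe)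
import Data.Maybe.Properties as Maybe
open import Data.Nat.Base using (ℕ; zero; suc; _+_; _*_; _^_; _≤_; _<_; z≤n; s≤s; _⊔_; ≢-nonZero)
import Data.Nat.Properties as ℕ
open import Data.Nat.Tactic.RingSolver using (solve-∀)
open import Data.Product.Base using (Σ-syntax; ∃-syntax; _×_; _,_; proj₁; proj₂)
import Data.Product.Properties as Product
open import Data.Rational.Base as ℚ using (ℚ; 0ℚ; 1ℚ)
import Data.Rational.Properties as ℚ
open import Data.Rational.Solver using (module +-*-Solver)
open import Data.Rational.Unnormalised.Base as ℚᵘ using (mkℚᵘ; *≡*)
import Data.Rational.Unnormalised.Properties as ℚᵘ
open import Data.Sum.Base using (_⊎_; inj₁; inj₂)
import Data.Sum.Properties as Sum
open import Data.Unit.Base using (⊤; tt)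
open import Data.Vec.Base as Vec using (Vec; []; _∷_; _++_; concat; replicate; _[_]≔_; lookup)
open import Data.Vec.Membership.Propositional using (_∈_)
open import Data.Vec.Membership.Propositional.Properties using (∈-map⁺)
import Data.Vec.Properties as Vec
open import Data.Vec.Relation.Unary.Any using (here; there; any?)
import Data.Vec.Relation.Unary.Any.Properties as Any
open import Function.Base using (_∘_; id)
open import Function.Definitions using (Injective)
open import Relation.Binary.Definitions using (DecidableEquality)
open import Relation.Binary.PropositionalEquality
open import Relation.Nullary using (Dec; yes; no; ¬_; contradiction)
open import Relation.Nullary.Decidable using (¬?; _×-dec_; _→-dec_; map′)
open import Relation.Unary using (Pred; _≬_)

-- Girth and amalgamation

-- A walk p —e₁— q₁ —e₂— q₂ ⋯ without backtracking (consecutive edges differ),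
-- indexed by its start, last edge, end and length.
data Walk {V E : Set} (I : V → E → Set) (p : V) : E → V → ℕ → Set where
  start : ∀ {e q} → I p e → I q e → p ≢ q → Walk I p e q 1
  extend : ∀ {e q n f r} → Walk I p e q n → e ≢ f → I q f → I r f → q ≢ r →
           Walk I p f r (suc n)

-- The first and last edge of a closed walk may coincide; a closed walk of length n
-- then still contains a cycle of length at most n.
Girth≥ : {V E : Set} → (V → E → Set) → ℕ → Set
Girth≥ I g = ∀ {p e n} → Walk I p e p n → g ≤ n

module _ {V E : Set} {I : V → E → Set} where

  1≤length : ∀ {p e q n} → Walk I p e q n → 1 ≤ n
  1≤length (start _ _ _)        = s≤s z≤n
  1≤length (extend _ _ _ _ _) = s≤s z≤n

  end∈edge : ∀ {p e q n} → Walk I p e q n → I q e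
  end∈edge (start _ q∈e _)        = q∈e
  end∈edge (extend _ _ _ r∈f _) = r∈f

mapWalk : ∀ {V E V′ E′ : Set} {I : V → E → Set} {I′ : V′ → E′ → Set}
          (φ : V → V′) (ψ : E → E′) →
          (∀ {p e} → I p e → I′ (φ p) (ψ e)) →
          (∀ {p q e} → I p e → I q e → φ p ≡ φ q → p ≡ q) →
          (∀ {e f} → ψ e ≡ ψ f → e ≡ f) →
          ∀ {p e q n} → Walk I p e q n → Walk I′ (φ p) (ψ e) (φ q) n
mapWalk φ ψ inc φ-inj ψ-inj (start p∈e q∈e p≢q) =
  start (inc p∈e) (inc q∈e) λ eq → p≢q (φ-inj p∈e q∈e eq)
mapWalk φ ψ inc φ-inj ψ-inj (extend w e≢f q∈f r∈f q≢r) =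
  extend (mapWalk φ ψ inc φ-inj ψ-inj w) (λ eq → e≢f (ψ-inj eq))
    (inc q∈f) (inc r∈f) (λ eq → q≢r (φ-inj q∈f r∈f eq))

-- Q is obtained by glueing copies of P, one for each edge of H, along the shared
-- vertices of P; ρ locates a shared vertex of Q in H.
record Amalgam {VP EP VH EH VQ EQ : Set}
               (P : VP → EP → Set) (H : VH → EH → Set) (Q : VQ → EQ → Set) : Set₁ where
  field
    _≟ᵛ_    : DecidableEquality VH
    _≟ᵉ_    : DecidableEquality EH
    ι       : EH → VP → VQ
    copy    : EQ → EH
    under   : EQ → EP
    Shared  : VP → Set
    ρ       : VQ → VH
    ι-inj   : ∀ {e p q} → ι e p ≡ ι e q → p ≡ q
    edge-inj : ∀ {ℓ m} → copy ℓ ≡ copy m → under ℓ ≡ under m → ℓ ≡ m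
    incident : ∀ {q ℓ} → Q q ℓ → ∃[ p ] (P p (under ℓ) × ι (copy ℓ) p ≡ q)
    overlap⇒shared : ∀ {e f p q} → e ≢ f → ι e p ≡ ι f q → Shared p
    ρ-incident : ∀ {e p} → Shared p → H (ρ (ι e p)) e
    ρ-inj   : ∀ {e f p q} → Shared p → Shared q → ρ (ι e p) ≡ ρ (ι f q) → ι e p ≡ ι f q
    shared-unique : ∀ {p q ℓ} → P p ℓ → P q ℓ → Shared p → Shared q → p ≡ q

module _ {VP EP VH EH VQ EQ : Set}
         {P : VP → EP → Set} {H : VH → EH → Set} {Q : VQ → EQ → Set}
         (A : Amalgam P H Q) {g h : ℕ} (gP : Girth≥ P g) (gH : Girth≥ H h) (g≤2h : g ≤ 2 * h)
  where
  open Amalgam A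

  private
    -- A passage that returns to its shared vertex is closed in `P`. Any other passage has at least
    -- two edges, because an edge of `P` has at most one shared vertex; this is the source of the
    -- factor 2 in `g ≤ 2 * h`.
    crossing : ∀ {e s r ℓ c} → Shared s → Shared r → Walk P s ℓ r c →
               g ≤ c ⊎ (ρ (ι e s) ≢ ρ (ι e r) × 2 ≤ c)
    crossing {e} {s} {r} sh-s sh-r w with ρ (ι e s) ≟ᵛ ρ (ι e r)
    ... | yes eq rewrite ι-inj (ρ-inj {e} {e} sh-s sh-r eq) = inj₁ (gP w)
    ... | no ne = inj₂ (ne , two w)
      where
      two : ∀ {ℓ c} → Walk P s ℓ r c → 2 ≤ c
      two (start s∈ℓ r∈ℓ s≢r) = contradiction (shared-unique s∈ℓ r∈ℓ sh-s sh-r) s≢r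
      two (extend w _ _ _ _) = s≤s (1≤length w)

    -- The trace in `H` of the copies traversed so far. An empty trace still records the copy `e`
    -- that was left, so that the next edge can be compared with it.
    data HWalk (v : VH) (e : EH) : EH → VH → ℕ → Set where
      empty : HWalk v e e v 0
      walk  : ∀ {f w m} → Walk H v f w m → HWalk v e f w m

    extendᴴ : ∀ {v e f w m e′ w′} → HWalk v e f w m → f ≢ e′ → H w e′ → H w′ e′ → w ≢ w′ →
              Walk H v e′ w′ (suc m)
    extendᴴ empty    f≢ i j w≢ = start i j w≢
    extendᴴ (walk w) f≢ i j w≢ = extend w f≢ i j w≢

    relocate : ∀ {v e x y m} → x ≡ y → Walk H v e (ρ x) m → Walk H v e (ρ y) m
    relocate refl w = w

    relocateᴴ : ∀ {v e f x y m} → x ≡ y → HWalk v e f (ρ x) m → HWalk v e f (ρ y) m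
    relocateᴴ refl w = w

    -- `across` cuts the walk into a first segment of length `a` that leaves its copy at `s`, then
    -- `m` complete passages with a trace in `H`, and a current segment of length `c` that began at
    -- `t`. Each complete passage has at least two edges, hence `2 * m`.
    data State (b : VQ) (ℓ : EQ) (q : VQ) (n : ℕ) : Set where
      inside : ∀ {p r} → ι (copy ℓ) p ≡ b → ι (copy ℓ) r ≡ q → Walk P p (under ℓ) r n →
               State b ℓ q n
      across : ∀ {e p s k a f m t r c} →
               ι e p ≡ b → Shared s → Walk P p k s a →
               HWalk (ρ (ι e s)) e f (ρ (ι (copy ℓ) t)) m → f ≢ copy ℓ →
               Shared t → ι (copy ℓ) r ≡ q → Walk P t (under ℓ) r c →
               2 * m + (a + c) ≤ n →
               State b ℓ q n

    continue : ∀ {e q r n ℓ m r′} → Walk P q e r n → copy ℓ ≡ copy m → e ≡ under ℓ → ℓ ≢ m →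
               ι (copy ℓ) r ≡ r′ → Q r′ m → ∀ {s′} → Q s′ m → r′ ≢ s′ →
               ∃[ s ] (ι (copy m) s ≡ s′ × Walk P q (under m) s (suc n))
    continue {r = r} {ℓ = ℓ} {m} w c≡ refl ℓ≢m refl r∈m s∈m r≢s
      with incident r∈m | incident s∈m
    ... | r₁ , r₁∈ , r₁≡ | s , s∈ , refl =
      s , refl , extend w (λ u≡ → ℓ≢m (edge-inj c≡ u≡)) (subst (λ z → P z (under m)) r₁≡r r₁∈) s∈
        λ r≡s → r≢s (trans (cong (λ z → ι z r) c≡) (cong (ι (copy m)) r≡s))
      where
      r₁≡r : r₁ ≡ r
      r₁≡r = ι-inj (trans r₁≡ (cong (λ z → ι z r) c≡))

    enter : ∀ {m q r} → Q q m → Q r m → q ≢ r →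
            ∃[ t ] ∃[ s ] (ι (copy m) t ≡ q × ι (copy m) s ≡ r × Walk P t (under m) s 1)
    enter q∈ r∈ q≢r with incident q∈ | incident r∈
    ... | t , t∈ , refl | s , s∈ , refl =
      t , s , refl , refl , start t∈ s∈ λ eq → q≢r (cong (ι _) eq)

    bound₁ : ∀ {m a c n} → 2 * m + (a + c) ≤ n → 2 * m + (a + suc c) ≤ suc n
    bound₁ {m} {a} {c} {n} le = subst (_≤ suc n) (eq m a c) (s≤s le)
      where
      eq : ∀ m a c → suc (2 * m + (a + c)) ≡ 2 * m + (a + suc c)
      eq = solve-∀

    bound₂ : ∀ {m a c n} → 2 ≤ c → 2 * m + (a + c) ≤ n → 2 * suc m + (a + 1) ≤ suc n
    bound₂ {m} {a} {c} {n} 2≤c le = begin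
      2 * suc m + (a + 1)     ≡⟨ eq m a ⟩
      suc (2 * m + (a + 2))   ≤⟨ s≤s (ℕ.+-monoʳ-≤ (2 * m) (ℕ.+-monoʳ-≤ a 2≤c)) ⟩
      suc (2 * m + (a + c))   ≤⟨ s≤s le ⟩
      suc n                   ∎
      where
      open ℕ.≤-Reasoning
      eq : ∀ m a → 2 * suc m + (a + 1) ≡ suc (2 * m + (a + 2))
      eq = solve-∀

    read : ∀ {b ℓ q n} → Walk Q b ℓ q n → g ≤ n ⊎ State b ℓ q n
    read (start p∈ q∈ p≢q) with enter p∈ q∈ p≢q
    ... | t , s , t≡ , s≡ , w = inj₂ (inside t≡ s≡ w)
    read (extend {ℓ} {q} {n} {m} w ℓ≢m q∈ r∈ q≢r) with read w
    ... | inj₁ g≤n = inj₁ (ℕ.m≤n⇒m≤1+n g≤n)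
    ... | inj₂ st with copy ℓ ≟ᵉ copy m | st
    ...   | yes c≡ | inside {p} p≡ r≡ w′ =
      let s , s≡ , w″ = continue w′ c≡ refl ℓ≢m r≡ q∈ r∈ q≢r
      in inj₂ (inside (trans (cong (λ z → ι z p) (sym c≡)) p≡) s≡ w″)
    ...   | yes c≡ | across {a = a} {m = k} {t} {c = c} b≡ sh w₁ wH f≢ sh-t r≡ w′ le =
      let s , s≡ , w″ = continue w′ c≡ refl ℓ≢m r≡ q∈ r∈ q≢r
      in inj₂ (across b≡ sh w₁ (relocateᴴ (cong (λ z → ι z t) c≡) wH)
                (λ eq → f≢ (trans eq (sym c≡))) sh-t s≡ w″ (bound₁ {k} {a} {c} le))
    ...   | no c≢ | inside p≡ r≡ w′ =
      let t , s , t≡ , s≡ , w″ = enter q∈ r∈ q≢r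
          sh-r = overlap⇒shared c≢ (trans r≡ (sym t≡))
          sh-t = overlap⇒shared (≢-sym c≢) (trans t≡ (sym r≡))
      in inj₂ (across p≡ sh-r w′ (relocateᴴ (trans r≡ (sym t≡)) empty)
                c≢ sh-t s≡ w″ (ℕ.≤-reflexive (ℕ.+-comm _ 1)))
    ...   | no c≢ | across {m = m} {t = t} {r} {c} b≡ sh w₁ wH f≢ sh-t r≡ w′ le
          with enter q∈ r∈ q≢r
    ...     | t′ , s , t≡ , s≡ , w″
            with crossing {copy ℓ} sh-t (overlap⇒shared c≢ (trans r≡ (sym t≡))) w′
    ...       | inj₁ g≤c = inj₁ (ℕ.m≤n⇒m≤1+n
                  (ℕ.≤-trans (ℕ.≤-trans g≤c (ℕ.≤-trans (ℕ.m≤n+m _ _) (ℕ.m≤n+m _ (2 * m)))) le))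
    ...       | inj₂ (ne , 2≤c) = inj₂ (across b≡ sh w₁
                  (walk (relocate (trans r≡ (sym t≡))
                    (extendᴴ wH f≢ (ρ-incident sh-t) (ρ-incident sh-r) ne)))
                  c≢ (overlap⇒shared (≢-sym c≢) (trans t≡ (sym r≡))) s≡ w″ (bound₂ {m} 2≤c le))
      where sh-r = overlap⇒shared c≢ (trans r≡ (sym t≡))

    -- A walk that never left its copy is closed in `P`. If it ends in its first copy, its trace is
    -- closed in `H` already or closes up with the edge `e`. If it ends in another copy, its start
    -- is a shared vertex; then the first or last segment is closed in `P`, or the trace closes up
    -- with the two edges `copy ℓ` and `e`.
    close : ∀ {b ℓ n} → State b ℓ b n → g ≤ n
    close {n = n} (inside {p} {r} p≡ r≡ w) with ι-inj (trans p≡ (sym r≡))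
    ... | refl = gP w
    close {b} {ℓ} {n} (across {e} {p} {s} {a = a} {m = m} {t} {r} {c} b≡ sh w₁ wH f≢ sh-t r≡ w le)
      with e ≟ᵉ copy ℓ
    ... | yes refl = lemma wH (ρ (ι e t) ≟ᵛ ρ (ι e s))
      where
      open ℕ.≤-Reasoning
      lemma : HWalk (ρ (ι e s)) e _ (ρ (ι e t)) m → _ → g ≤ n
      lemma wH (no ne) = begin
        g                ≤⟨ g≤2h ⟩
        2 * h            ≤⟨ ℕ.*-monoʳ-≤ 2 (gH (extendᴴ wH f≢ (ρ-incident sh-t) (ρ-incident sh) ne)) ⟩
        2 * suc m        ≡⟨ trans (ℕ.*-suc 2 m) (ℕ.+-comm 2 _) ⟩
        2 * m + (1 + 1)  ≤⟨ ℕ.+-monoʳ-≤ (2 * m) (ℕ.+-mono-≤ (1≤length w₁) (1≤length w)) ⟩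
        2 * m + (a + c)  ≤⟨ le ⟩
        n                ∎
      lemma wH (yes eq) = go wH eq f≢
        where
        go : ∀ {f v} → HWalk (ρ (ι e s)) e f v m → v ≡ ρ (ι e s) → f ≢ e → g ≤ n
        go empty _ f≢ = contradiction refl f≢
        go (walk w′) refl _ = begin
          g                ≤⟨ g≤2h ⟩
          2 * h            ≤⟨ ℕ.*-monoʳ-≤ 2 (gH w′) ⟩
          2 * m            ≤⟨ ℕ.m≤m+n _ _ ⟩
          2 * m + (a + c)  ≤⟨ le ⟩
          n                ∎
    ... | no e≢ with crossing {e} sh-p sh w₁ | crossing {copy ℓ} sh-t sh-r w
      where
      sh-p = overlap⇒shared e≢ (trans b≡ (sym r≡))
      sh-r = overlap⇒shared (≢-sym e≢) (trans r≡ (sym b≡))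
    ...   | inj₁ g≤a | _ = ℕ.≤-trans g≤a (ℕ.≤-trans (ℕ.≤-trans (ℕ.m≤m+n _ _) (ℕ.m≤n+m _ (2 * m))) le)
    ...   | _ | inj₁ g≤c = ℕ.≤-trans g≤c (ℕ.≤-trans (ℕ.≤-trans (ℕ.m≤n+m _ _) (ℕ.m≤n+m _ (2 * m))) le)
    ...   | inj₂ (ne₁ , 2≤a) | inj₂ (ne₂ , 2≤c) = begin
        g                  ≤⟨ g≤2h ⟩
        2 * h              ≤⟨ ℕ.*-monoʳ-≤ 2 (gH (extend (relocate r≡p w₂)
                                (≢-sym e≢) (ρ-incident sh-p) (ρ-incident sh) ne₁)) ⟩
        2 * suc (suc m)    ≡⟨ eq m ⟩
        2 * m + (2 + 2)    ≤⟨ ℕ.+-monoʳ-≤ (2 * m) (ℕ.+-mono-≤ 2≤a 2≤c) ⟩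
        2 * m + (a + c)    ≤⟨ le ⟩
        n                  ∎
      where
      open ℕ.≤-Reasoning
      r≡p = trans r≡ (sym b≡)
      sh-p = overlap⇒shared e≢ (sym r≡p)
      sh-r = overlap⇒shared (≢-sym e≢) r≡p
      w₂ = extendᴴ wH f≢ (ρ-incident sh-t) (ρ-incident sh-r) ne₂
      eq : ∀ m → 2 * suc (suc m) ≡ 2 * m + (2 + 2)
      eq = solve-∀

  amalgam-girth : Girth≥ Q g
  amalgam-girth w with read w
  ... | inj₁ g≤n = g≤n
  ... | inj₂ st  = close st

-- The Hales–Jewett theorem

encode : ∀ {n N} → Vec (Fin n) N → Fin (n ^ N)
encode []      = zero
encode (x ∷ w) = Fin.combine x (encode w)

decode : ∀ {n} N → Fin (n ^ N) → Vec (Fin n) N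
decode zero        _ = []
decode {n} (suc N) i = let x , j = Fin.remQuot {n} (n ^ N) i in x ∷ decode N j

decode-encode : ∀ {n N} (w : Vec (Fin n) N) → decode N (encode w) ≡ w
decode-encode []      = refl
decode-encode {n} {suc N} (x ∷ w) =
  trans (cong (λ (y , j) → y ∷ decode N j) (Fin.remQuot-combine {n} {n ^ N} x (encode w)))
        (cong (x ∷_) (decode-encode w))

encode-decode : ∀ {n} N (i : Fin (n ^ N)) → encode (decode N i) ≡ i
encode-decode zero        zero = refl
encode-decode {n} (suc N) i    =
  trans (cong (Fin.combine (Fin.quotient {n} (n ^ N) i)) (encode-decode {n} N _)) (Fin.combine-remQuot {n} (n ^ N) i)

encode-injective : ∀ {n N} {v w : Vec (Fin n) N} → encode v ≡ encode w → v ≡ w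
encode-injective {N = N} eq = trans (sym (decode-encode _)) (trans (cong (decode N) eq) (decode-encode _))

-- A template is a word with the variable letter `nothing`; substituting all letters
-- for the variable yields a combinatorial line (when the variable occurs).
Template : Set → ℕ → Set
Template A = Vec (Maybe A)

fill : ∀ {A : Set} {N} → A → Template A N → Vec A N
fill a = Vec.map (fromMaybe a)

HasVariable : ∀ {A : Set} {N} → Template A N → Set
HasVariable t = nothing ∈ t

fill-constant : ∀ {A : Set} {N} (a : A) (w : Vec A N) → fill a (Vec.map just w) ≡ w
fill-constant a w = trans (sym (Vec.map-∘ _ _ w)) (Vec.map-id w)

fill-++ : ∀ {A : Set} {M N} (a : A) (s : Template A M) (t : Template A N) →
          fill a (s ++ t) ≡ fill a s ++ fill a t
fill-++ a = Vec.map-++ (fromMaybe a)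

fill-constant-++ : ∀ {A : Set} {M N} (a : A) (w : Vec A M) (t : Template A N) →
                   fill a (Vec.map just w ++ t) ≡ w ++ fill a t
fill-constant-++ a w t = trans (fill-++ a (Vec.map just w) t) (cong (_++ fill a t) (fill-constant a w))

fill-map : ∀ {A B : Set} (f : A → B) {N} (a : A) (t : Template A N) →
           fill (f a) (Vec.map (Maybe.map f) t) ≡ Vec.map f (fill a t)
fill-map f a []            = refl
fill-map f a (just x ∷ t)  = cong (f x ∷_) (fill-map f a t)
fill-map f a (nothing ∷ t) = cong (f a ∷_) (fill-map f a t)

fill-injective : ∀ {A : Set} {N} {t : Template A N} → HasVariable t →
                 ∀ {a b} → fill a t ≡ fill b t → a ≡ b
fill-injective {t = .nothing ∷ _} (here refl) eq = Vec.∷-injectiveˡ eq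
fill-injective {t = _ ∷ _}        (there v)   eq = fill-injective v (Vec.∷-injectiveʳ eq)

Monochromatic : ∀ {n N k} → (Vec (Fin n) N → Fin k) → Template (Fin n) N → Set
Monochromatic f t = ∀ x y → f (fill x t) ≡ f (fill y t)

MonochromaticLine : ∀ {n N k} → (Vec (Fin n) N → Fin k) → Set
MonochromaticLine {n} {N} f = Σ[ t ∈ Template (Fin n) N ] (HasVariable t × Monochromatic f t)

-- Colourings of the words of length N are themselves finitely many.
encodeColouring : ∀ n N k → Σ[ K ∈ ℕ ] Σ[ enc ∈ ((Vec (Fin n) N → Fin k) → Fin K) ]
                  (∀ f g → enc f ≡ enc g → ∀ w → f w ≡ g w)
encodeColouring n zero    k = k , (λ f → f []) , λ { f g eq [] → eq }
encodeColouring n (suc N) k with encodeColouring n N k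
... | K , enc , enc-inj = K ^ n , (λ f → Fin.funToFin (row f)) , inj
  where
  row : (Vec (Fin n) (suc N) → Fin k) → Fin n → Fin K
  row f x = enc (λ w → f (x ∷ w))
  inj : ∀ f g → Fin.funToFin (row f) ≡ Fin.funToFin (row g) → ∀ w → f w ≡ g w
  inj f g eq (x ∷ w) = enc-inj _ _
    (trans (sym (Fin.finToFun-funToFin (row f) x))
      (trans (cong (λ i → Fin.finToFun i x) eq) (Fin.finToFun-funToFin (row g) x))) w

HalesJewett : ℕ → Set
HalesJewett n = ∀ k → ∃[ N ] (∀ (f : Vec (Fin n) N → Fin k) → MonochromaticLine f)

-- Colour focusing: r lines through a common word w at the letter zero, each of
-- them monochromatic away from w, in distinct colours.
Focused : ∀ {n N k} → (Vec (Fin (suc n)) N → Fin k) → ℕ → Set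
Focused {n} {N} {k} f r =
  Σ[ w ∈ Vec (Fin (suc n)) N ] Σ[ colour ∈ (Fin r → Fin k) ]
    ( (∀ i j → colour i ≡ colour j → i ≡ j)
    × (∀ i → Σ[ t ∈ Template (Fin (suc n)) N ]
         (HasVariable t × fill zero t ≡ w × (∀ x → f (fill (suc x) t) ≡ colour i))))

module _ {n : ℕ} (hj : HalesJewett (suc n)) (k : ℕ) where

  -- Take the colouring of all continuations of length `N` as one colour: `hj` yields a template `L`
  -- over the non-zero letters whose points are interchangeable in front of any continuation. The
  -- `r` focused lines are prolonged by `L`, and `L` followed by the constant `w` is a new one. If
  -- the colour `g w` occurs among the old lines already, the old line of that colour is
  -- monochromatic at the letter zero too.
  focus : ∀ r → ∃[ N ] (∀ (f : Vec (Fin (2 + n)) N → Fin k) → MonochromaticLine f ⊎ Focused f r)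
  focus zero = 0 , λ f → inj₂ ([] , (λ ()) , (λ ()) , λ ())
  focus (suc r) with focus r
  ... | N , hN with encodeColouring (2 + n) N k
  ...   | K , enc , enc-inj with hj K
  ...     | N′ , hN′ = N′ + N , λ f → step f (hN′ (λ u → enc (λ v → f (Vec.map suc u ++ v))))
    where
    step : ∀ (f : Vec (Fin (2 + n)) (N′ + N) → Fin k) →
           MonochromaticLine (λ u → enc (λ v → f (Vec.map suc u ++ v))) →
           MonochromaticLine f ⊎ Focused f (suc r)
    step f (t₀ , var , mono) = conclude (hN g)
      where
      L = Vec.map (Maybe.map suc) t₀
      g : Vec (Fin (2 + n)) N → Fin k
      g v = f (fill (suc zero) L ++ v)
      var-L : HasVariable L
      var-L = ∈-map⁺ (Maybe.map suc) var
      f≡g : ∀ x v → f (fill (suc x) L ++ v) ≡ g v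
      f≡g x v rewrite fill-map {B = Fin (2 + n)} suc x t₀ | fill-map {B = Fin (2 + n)} suc zero t₀ =
        enc-inj _ _ (mono x zero) v
      liftLine : MonochromaticLine g → MonochromaticLine f
      liftLine (t , v , m) = Vec.map just w₀ ++ t , Any.++⁺ʳ _ v , λ x y →
        trans (cong f (fill-constant-++ x w₀ t)) (trans (m x y) (sym (cong f (fill-constant-++ y w₀ t))))
        where w₀ = fill (suc zero) L
      conclude : MonochromaticLine g ⊎ Focused g r → MonochromaticLine f ⊎ Focused f (suc r)
      conclude (inj₁ ml) = inj₁ (liftLine ml)
      conclude (inj₂ (w , colour , colour-inj , lines)) with Fin.any? (λ i → colour i Fin.≟ g w)
      ... | yes (i , eq) with lines i
      ...   | t , v , t0 , c = inj₁ (liftLine (t , v , λ x y → trans (mono′ x) (sym (mono′ y))))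
        where
        mono′ : ∀ x → g (fill x t) ≡ g w
        mono′ zero    = cong g t0
        mono′ (suc x) = trans (c x) eq
      conclude (inj₂ (w , colour , colour-inj , lines)) | no new =
        inj₂ (fill zero L ++ w , colour′ , colour′-inj , lines′)
        where
        colour′ : Fin (suc r) → Fin k
        colour′ zero    = g w
        colour′ (suc i) = colour i
        colour′-inj : ∀ i j → colour′ i ≡ colour′ j → i ≡ j
        colour′-inj zero    zero    eq = refl
        colour′-inj zero    (suc j) eq = contradiction (j , sym eq) new
        colour′-inj (suc i) zero    eq = contradiction (i , eq) new
        colour′-inj (suc i) (suc j) eq = cong suc (colour-inj i j eq)
        lines′ : ∀ i → Σ[ t ∈ Template (Fin (2 + n)) (N′ + N) ]
          (HasVariable t × fill zero t ≡ fill zero L ++ w × (∀ x → f (fill (suc x) t) ≡ colour′ i))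
        lines′ zero = L ++ Vec.map just w , Any.++⁺ˡ var-L ,
          trans (fill-++ zero L _) (cong (fill zero L ++_) (fill-constant zero w)) ,
          λ x → trans (cong f (trans (fill-++ (suc x) L _) (cong (fill (suc x) L ++_) (fill-constant (suc x) w)))) (f≡g x w)
        lines′ (suc i) with lines i
        ... | t , v , t0 , c = L ++ t , Any.++⁺ˡ var-L ,
          trans (fill-++ zero L t) (cong (fill zero L ++_) t0) ,
          λ x → trans (cong f (fill-++ (suc x) L t)) (trans (f≡g x _) (c x))

-- Induction on the alphabet: `k + 1` focused lines would need as many distinct colours, so the
-- other alternative of `focus` must hold.
hales-jewett : ∀ n → HalesJewett (suc n)
hales-jewett zero    k = 1 , λ f → nothing ∷ [] , here refl , λ { zero zero → refl }
hales-jewett (suc n) k with focus (hales-jewett n) k (suc k)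
... | N , hN = N , λ f → conclude f (hN f)
  where
  conclude : ∀ (f : Vec (Fin (2 + n)) N → Fin k) → MonochromaticLine f ⊎ Focused f (suc k) → MonochromaticLine f
  conclude f (inj₁ line)                          = line
  conclude f (inj₂ (_ , colour , colour-inj , _)) =
    contradiction (Fin.injective⇒≤ {f = colour} (colour-inj _ _)) (ℕ.n≮n k)

-- The sparse Hales–Jewett theorem

OnLine : ∀ {A E : Set} {N} → (E → Template A N) → Vec A N → E → Set
OnLine line w e = ∃[ a ] fill a (line e) ≡ w

record SparseHalesJewett (n k g : ℕ) : Set where
  field
    length count  : ℕ
    line          : Fin count → Template (Fin n) length
    hasVariable   : ∀ e → HasVariable (line e)
    monochromatic : ∀ (f : Vec (Fin n) length → Fin k) → ∃[ e ] Monochromatic f (line e)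
    girth         : Girth≥ (OnLine line) g

-- Words made of blocks

concat-injective : ∀ {A : Set} {m n} (xss yss : Vec (Vec A m) n) → concat xss ≡ concat yss → xss ≡ yss
concat-injective []         []         _  = refl
concat-injective (xs ∷ xss) (ys ∷ yss) eq =
  cong₂ _∷_ (Vec.++-injectiveˡ xs ys eq) (concat-injective xss yss (Vec.++-injectiveʳ xs ys eq))

take-++ : ∀ {A : Set} m {n} (xs : Vec A m) (ys : Vec A n) → Vec.take m (xs ++ ys) ≡ xs
take-++ m xs ys = Vec.++-injectiveˡ _ xs (Vec.take++drop≡id m (xs ++ ys))

-- A letter of `B` stands for a block of `M` letters. With a word for `s` the result is a point of
-- the line `t` over the alphabet of blocks; with a template it is a line inside that line.
expand : ∀ {A B : Set} {M N} → (B → Vec A M) → Template B N → Vec A M → Vec A (N * M)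
expand block t s = concat (Vec.map (maybe block s) t)

fill-expand : ∀ {A B : Set} {M N} (block : B → Vec A M) (t : Template B N) (s : Template A M) a →
              fill a (expand (Vec.map just ∘ block) t s) ≡ expand block t (fill a s)
fill-expand block t s a = trans (Vec.map-concat (fromMaybe a) (Vec.map (maybe (Vec.map just ∘ block) s) t))
  (cong concat (trans (sym (Vec.map-∘ _ _ t)) (Vec.map-cong letter t)))
  where
  letter : ∀ b → fill a (maybe (Vec.map just ∘ block) s b) ≡ maybe block (fill a s) b
  letter (just b) = fill-constant a (block b)
  letter nothing  = refl

expand-decode : ∀ {n M N} (t : Template (Fin (n ^ M)) N) s →
                expand (decode M) t s ≡ concat (Vec.map (decode {n} M) (fill (encode s) t))
expand-decode {n} {M} t s = cong concat (trans (Vec.map-cong letter t) (Vec.map-∘ _ _ t))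
  where
  letter : ∀ b → maybe (decode M) s b ≡ decode {n} M (fromMaybe (encode s) b)
  letter (just b) = refl
  letter nothing  = sym (decode-encode s)

contract : ∀ {n} M N → Vec (Fin n) (N * M) → Vec (Fin (n ^ M)) N
contract M N w = Vec.map encode (proj₁ (Vec.group N M w))

contract-concat : ∀ {n M N} (w : Vec (Fin (n ^ M)) N) → contract M N (concat (Vec.map (decode {n} M) w)) ≡ w
contract-concat {n} {M} {N} w = begin
  Vec.map encode (proj₁ (Vec.group N M v))
    ≡⟨ cong (Vec.map encode) (sym (concat-injective (Vec.map (decode {n} M) w) _ (proj₂ (Vec.group N M v)))) ⟩
  Vec.map encode (Vec.map (decode {n} M) w)     ≡⟨ Vec.map-∘ _ _ w ⟨
  Vec.map (encode ∘ decode {n} M) w             ≡⟨ Vec.map-cong (encode-decode {n} M) w ⟩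
  Vec.map (λ x → x) w                           ≡⟨ Vec.map-id w ⟩
  w                                             ∎
  where
  open ≡-Reasoning
  v = concat (Vec.map (decode {n} M) w)

contract-expand : ∀ {n M N} (t : Template (Fin (n ^ M)) N) s →
                  contract {n} M N (expand (decode M) t s) ≡ fill (encode s) t
contract-expand {n} {M} {N} t s =
  trans (cong (contract M N) (expand-decode {n} {M} t s)) (contract-concat {n} {M} _)

-- Separates the copies of a point x ≢ a while keeping the copies of a together.
spread : ∀ {A : Set} {N c} → Vec A N → Fin c → Vec A N → Vec A (c * N)
spread {c = c} a e x = concat (replicate c a [ e ]≔ x)

fill-spread : ∀ {A : Set} {N c} (a : Vec A N) (e : Fin c) (t : Template A N) b →
              fill b (spread (Vec.map just a) e t) ≡ spread a e (fill b t)
fill-spread {c = c} a e t b = trans (Vec.map-concat (fromMaybe b) (replicate c (Vec.map just a) [ e ]≔ t)) (cong concat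
  (trans (Vec.map-[]≔ (fill b) (replicate c (Vec.map just a)) e)
    (cong (_[ e ]≔ fill b t) (trans (Vec.map-replicate _ _ c) (cong (replicate c) (fill-constant b a))))))

spread-self : ∀ {A : Set} {N c} (a : Vec A N) (e : Fin c) → spread a e a ≡ concat (replicate c a)
spread-self {c = c} a e = cong concat
  (trans (cong (replicate c a [ e ]≔_) (sym (Vec.lookup-replicate e a))) (Vec.[]≔-lookup (replicate c a) e))

-- Block `e` holds `x` in the left word and the default `a` in the right one.
spread-separates : ∀ {A : Set} {N c} {a : Vec A N} {e f : Fin c} {x y} → e ≢ f →
                   spread a e x ≡ spread a f y → x ≡ a
spread-separates {c = c} {a} {e} {f} {x} {y} e≢f eq = begin
  x                                  ≡⟨ Vec.lookup∘update e (replicate c a) x ⟨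
  lookup (replicate c a [ e ]≔ x) e  ≡⟨ cong (λ v → lookup v e) (concat-injective (replicate c a [ e ]≔ x) (replicate c a [ f ]≔ y) eq) ⟩
  lookup (replicate c a [ f ]≔ y) e  ≡⟨ Vec.lookup∘update′ e≢f (replicate c a) y ⟩
  lookup (replicate c a) e           ≡⟨ Vec.lookup-replicate e a ⟩
  a                                  ∎
  where open ≡-Reasoning

-- Enumeration of the combinatorial lines

allVecs : ∀ {A : Set} → List A → ∀ N → List (Vec A N)
allVecs xs zero    = List.[ [] ]
allVecs xs (suc N) = List.cartesianProductWith _∷_ xs (allVecs xs N)

∈-allVecs : ∀ {A : Set} {xs : List A} → (∀ x → x ∈ˡ xs) → ∀ {N} (w : Vec A N) → w ∈ˡ allVecs xs N
∈-allVecs all []      = hereˡ refl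
∈-allVecs all (x ∷ w) = ∈-cartesianProductWith⁺ _∷_ (all x) (∈-allVecs all w)

hasVariable? : ∀ {n N} (t : Template (Fin n) N) → Dec (HasVariable t)
hasVariable? = any? (Maybe.≡-dec Fin._≟_ nothing)

lines : ∀ n N → List (Template (Fin n) N)
lines n N = List.filter hasVariable? (allVecs (nothing List.∷ List.map just (List.allFin n)) N)

∈-lines : ∀ {n N} {t : Template (Fin n) N} → HasVariable t → t ∈ˡ lines n N
∈-lines v = ∈-filter⁺ hasVariable? (∈-allVecs letters _) v
  where
  letters : ∀ x → x ∈ˡ _
  letters nothing  = hereˡ refl
  letters (just x) = thereˡ (∈ˡ-map⁺ just (∈-allFin x))

lines-haveVariable : ∀ n N e → HasVariable (List.lookup (lines n N) e)
lines-haveVariable n N e = proj₂ (∈-filter⁻ hasVariable?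
  {xs = allVecs (nothing List.∷ List.map just (List.allFin n)) N} (∈-lookup {xs = lines n N} e))

-- The partite construction

OnPair : ∀ {A E : Set} {M N} → (E → Template A N) → (E → Template A M) → Vec A N × Vec A M → E → Set
OnPair base suffix p e = ∃[ a ] (fill a (base e) , fill a (suffix e)) ≡ p

-- The words are split as base ++ suffix, and a part consists of all words with a
-- given base. Only colourings that are constant on the parts in B are required to
-- have a monochromatic edge.
record Stage (n k g N : ℕ) (B : List (Vec (Fin n) N)) : Set where
  field
    {extra count} : ℕ
    base          : Fin count → Template (Fin n) N
    hasVariable   : ∀ e → HasVariable (base e)
    suffix        : Fin count → Template (Fin n) extra
    monochromatic : ∀ (f : Vec (Fin n) N → Vec (Fin n) extra → Fin k) →
                    (∀ {a} → a ∈ˡ B → ∀ s s′ → f a s ≡ f a s′) →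
                    ∃[ e ] (∀ x y → f (fill x (base e)) (fill x (suffix e)) ≡ f (fill y (base e)) (fill y (suffix e)))
    girth         : Girth≥ (OnPair base suffix) g

module _ {n k N : ℕ} (hj : ∀ (f : Vec (Fin (2 + n)) N → Fin k) → MonochromaticLine f) where

  private
    X = Fin (2 + n)

  marker : ∀ {c} → Fin c → Vec X c
  marker {c} e = replicate c zero [ e ]≔ suc zero

  marker-injective : ∀ {c} {e f : Fin c} → marker e ≡ marker f → e ≡ f
  marker-injective {c} {e} {f} eq with e Fin.≟ f
  ... | yes e≡f = e≡f
  ... | no  e≢f with trans (sym (Vec.lookup∘update e (replicate c zero) (suc zero)))
                    (trans (cong (λ v → lookup v e) eq)
                    (trans (Vec.lookup∘update′ e≢f (replicate c zero) (suc zero)) (Vec.lookup-replicate e zero)))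
  ...   | ()

  -- The markers make the combinatorial lines pairwise disjoint.
  initial : ∀ g → Stage (2 + n) k g N (allVecs (List.allFin (2 + n)) N)
  initial g = record
    { base          = List.lookup ls
    ; hasVariable   = lines-haveVariable (2 + n) N
    ; suffix        = λ e → Vec.map just (marker e)
    ; monochromatic = mono
    ; girth         = girth′
    }
    where
    ls = lines (2 + n) N
    mono : ∀ f → _ → _
    -- All words belong to the list, so `f` ignores the suffix and the all-zero suffix can stand for
    -- every other one.
    mono f const with hj (λ a → f a (replicate _ zero))
    ... | t , v , m = AnyL.index t∈ , λ x y → trans (eq x) (trans (m x y) (sym (eq y)))
      where
      t∈ : t ∈ˡ ls
      t∈ = ∈-lines v
      eq : ∀ x → f (fill x (List.lookup ls (AnyL.index t∈))) (fill x (Vec.map just (marker (AnyL.index t∈))))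
                 ≡ f (fill x t) (replicate _ zero)
      eq x = trans (const (∈-allVecs ∈-allFin _) _ _)
        (cong (λ u → f (fill x u) (replicate _ zero)) (sym (AnyL.lookup-index t∈)))
    same : ∀ {p e f} → OnPair (List.lookup ls) (λ e → Vec.map just (marker e)) p e →
           OnPair (List.lookup ls) (λ e → Vec.map just (marker e)) p f → e ≡ f
    same {e = e} {f} (a , eq) (b , eq′) = marker-injective (trans (sym (fill-constant a (marker e)))
      (trans (Product.,-injectiveʳ (trans eq (sym eq′))) (fill-constant b (marker f))))
    girth′ : Girth≥ _ g
    girth′ (start _ _ p≢p) = contradiction refl p≢p
    girth′ (extend w e≢f q∈f _ _) = contradiction (same (end∈edge w) q∈f) e≢f

module _ {n k g h N : ℕ} (g≤2h : g ≤ 2 * h) (a : Vec (Fin n) N) {B : List (Vec (Fin n) N)}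
         (P : Stage n k g N (a List.∷ B)) (H : SparseHalesJewett (n ^ Stage.extra P) k h) where

  private
    module P = Stage P
    module H = SparseHalesJewett H
    M  = P.extra
    M′ = H.length * M + H.count * N

    -- The first half of the new suffix puts `s`, read as a single letter, on the line `e` of `H`.
    -- The second half makes different copies disjoint outside the part of `a`.
    ι : Fin H.count → Vec (Fin n) N × Vec (Fin n) M → Vec (Fin n) N × Vec (Fin n) M′
    ι e (x , s) = x , expand (decode M) (H.line e) s ++ spread a e x

    copy : Fin (H.count * P.count) → Fin H.count
    copy = Fin.quotient {H.count} P.count

    under : Fin (H.count * P.count) → Fin P.count
    under = Fin.remainder {H.count} P.count

    suffix : Fin (H.count * P.count) → Template (Fin n) M′
    suffix ℓ = expand (Vec.map just ∘ decode M) (H.line (copy ℓ)) (P.suffix (under ℓ))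
               ++ spread (Vec.map just a) (copy ℓ) (P.base (under ℓ))

    fill-ι : ∀ x ℓ → (fill x (P.base (under ℓ)) , fill x (suffix ℓ)) ≡
                     ι (copy ℓ) (fill x (P.base (under ℓ)) , fill x (P.suffix (under ℓ)))
    fill-ι x ℓ = cong (fill x (P.base (under ℓ)) ,_) (trans (fill-++ x (expand (Vec.map just ∘ decode M) (H.line (copy ℓ)) _) _)
      (cong₂ _++_ (fill-expand (decode M) (H.line (copy ℓ)) _ x) (fill-spread a (copy ℓ) _ x)))

    ρ : Vec (Fin n) N × Vec (Fin n) M′ → Vec (Fin (n ^ M)) H.length
    ρ (_ , w) = contract M H.length (Vec.take (H.length * M) w)

    ρ-ι : ∀ e x s → ρ (ι e (x , s)) ≡ fill (encode s) (H.line e)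
    ρ-ι e x s = trans (cong (contract M H.length) (take-++ (H.length * M) _ _)) (contract-expand (H.line e) s)

    -- On the part of a, the copy of H.line e is recovered from its image under ρ.
    ι-part : ∀ e s → ι e (a , s) ≡ (a , concat (Vec.map (decode M) (ρ (ι e (a , s)))) ++ concat (replicate H.count a))
    ι-part e s = cong (a ,_) (cong₂ _++_
      (trans (expand-decode (H.line e) s) (cong (concat ∘ Vec.map (decode M)) (sym (ρ-ι e a s))))
      (spread-self a e))

    amalgam : Amalgam (OnPair P.base P.suffix) (OnLine H.line) (OnPair (P.base ∘ under) suffix)
    amalgam = record
      { _≟ᵛ_ = Vec.≡-dec Fin._≟_
      ; _≟ᵉ_ = Fin._≟_
      ; ι = ι
      ; copy = copy
      ; under = under
      ; Shared = λ (x , _) → x ≡ a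
      ; ρ = ρ
      ; ι-inj = λ {e} {(x , s)} {(y , t)} eq → cong₂ _,_ (Product.,-injectiveˡ eq)
          (encode-injective (fill-injective (H.hasVariable e)
            (trans (sym (ρ-ι e x s)) (trans (cong ρ eq) (ρ-ι e y t)))))
      ; edge-inj = λ {ℓ} {m} c≡ u≡ → trans (sym (Fin.combine-remQuot {H.count} P.count ℓ))
          (trans (cong₂ Fin.combine c≡ u≡) (Fin.combine-remQuot {H.count} P.count m))
      ; incident = λ { {ℓ = ℓ} (x , refl) → _ , (x , refl) , sym (fill-ι x ℓ) }
      ; overlap⇒shared = λ {e} {f} {p} {q} e≢f eq → spread-separates e≢f
          (Vec.++-injectiveʳ (expand (decode M) (H.line e) (proj₂ p)) (expand (decode M) (H.line f) (proj₂ q))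
            (Product.,-injectiveʳ eq))
      ; ρ-incident = λ {e} {p} _ → encode (proj₂ p) , sym (ρ-ι e (proj₁ p) (proj₂ p))
      ; ρ-inj = λ { {e} {f} {_ , s} {_ , t} refl refl eq → trans (ι-part e s)
          (trans (cong (λ w → a , concat (Vec.map (decode M) w) ++ concat (replicate H.count a)) eq) (sym (ι-part f t))) }
      -- The base of an edge contains the variable, so an edge has at most one vertex in the part of
      -- `a`.
      ; shared-unique = λ { {ℓ = ℓ} (x , refl) (y , refl) x≡ y≡ →
          cong (λ z → fill z (P.base ℓ) , fill z (P.suffix ℓ)) (fill-injective (P.hasVariable ℓ) (trans x≡ (sym y≡))) }
      }

  -- A colouring of the part of `a` induces a colouring of the words of `H`. Along a monochromatic
  -- line `e` the copy of `P` has its part of `a` in one colour, so the colouring property of `P`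
  -- applies to this copy.
  amalgamate : Stage n k g N B
  amalgamate = record
    { base          = P.base ∘ under
    ; hasVariable   = P.hasVariable ∘ under
    ; suffix        = suffix
    ; monochromatic = mono
    ; girth         = amalgam-girth amalgam P.girth H.girth g≤2h
    }
    where
    mono : ∀ (f : Vec (Fin n) N → Vec (Fin n) M′ → Fin k) →
           (∀ {b} → b ∈ˡ B → ∀ s s′ → f b s ≡ f b s′) → ∃[ ℓ ] _
    mono f const with H.monochromatic (λ w → f a (concat (Vec.map (decode M) w) ++ concat (replicate H.count a)))
    ... | e , mono-e with P.monochromatic (λ x s → f x (proj₂ (ι e (x , s)))) const′
      where
      const′ : ∀ {b} → b ∈ˡ a List.∷ B → ∀ s s′ → f b (proj₂ (ι e (b , s))) ≡ f b (proj₂ (ι e (b , s′)))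
      const′ (thereˡ b∈) s s′ = const b∈ _ _
      const′ (hereˡ refl) s s′ = trans (eq s) (trans (mono-e _ _) (sym (eq s′)))
        where
        eq : ∀ s → f a (proj₂ (ι e (a , s))) ≡
             f a (concat (Vec.map (decode M) (fill (encode s) (H.line e))) ++ concat (replicate H.count a))
        eq s = cong (f a) (trans (Product.,-injectiveʳ (ι-part e s))
          (cong (λ w → concat (Vec.map (decode M) w) ++ concat (replicate H.count a)) (ρ-ι e a s)))
    ...   | ℓ , mono-ℓ = Fin.combine e ℓ , λ x y → trans (eq x) (trans (mono-ℓ x y) (sym (eq y)))
      where
      eq : ∀ x → f (fill x (P.base (under (Fin.combine e ℓ)))) (fill x (suffix (Fin.combine e ℓ))) ≡
                 f (fill x (P.base ℓ)) (proj₂ (ι e (fill x (P.base ℓ) , fill x (P.suffix ℓ))))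
      eq x = trans (cong (λ (y , s) → f y s) (fill-ι x (Fin.combine e ℓ)))
        (cong (λ (e′ , ℓ′) → f (fill x (P.base ℓ′)) (proj₂ (ι e′ (fill x (P.base ℓ′) , fill x (P.suffix ℓ′)))))
          (Fin.remQuot-combine {H.count} {P.count} e ℓ))

-- Each amalgamation removes one word from the list. It also changes the length of the suffixes, and
-- with it the alphabet of the next `H`, so `H` is supplied for all alphabets.
amalgamateAll : ∀ {n k g h N} → g ≤ 2 * h → (∀ m → SparseHalesJewett m k h) →
                ∀ B → Stage n k g N B → Stage n k g N List.[]
amalgamateAll g≤2h H List.[]       P = P
amalgamateAll g≤2h H (a List.∷ B) P = amalgamateAll g≤2h H B (amalgamate g≤2h a P (H _))

fromStage : ∀ {n k g N} → Stage n k g N List.[] → SparseHalesJewett n k g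
fromStage {n} {k} {g} {N} P = record
  { length        = N + extra
  ; count         = count
  ; line          = λ e → base e ++ suffix e
  ; hasVariable   = λ e → Any.++⁺ˡ (hasVariable e)
  ; monochromatic = λ f → let e , mono = monochromatic (λ x s → f (x ++ s)) (λ ())
                          in e , λ x y → trans (cong f (fill-++ x (base e) _)) (trans (mono x y) (sym (cong f (fill-++ y (base e) _))))
  ; girth         = λ w → girth (mapWalk (λ w → Vec.take N w , Vec.drop N w) (λ e → e)
      (λ { {e = e} (x , refl) → x , sym (splits e x) })
      (λ {p} {q} _ _ eq → trans (sym (Vec.take++drop≡id N p)) (trans (cong (λ (u , v) → u ++ v) eq) (Vec.take++drop≡id N q)))
      (λ eq → eq) w)
  }
  where
  open Stage P
  splits : ∀ e x → (Vec.take N (fill x (base e ++ suffix e)) , Vec.drop N (fill x (base e ++ suffix e))) ≡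
                   (fill x (base e) , fill x (suffix e))
  splits e x = cong₂ _,_ (Vec.++-injectiveˡ _ _ eq) (Vec.++-injectiveʳ (Vec.take N w) _ eq)
    where
    w = fill x (base e ++ suffix e)
    eq = trans (Vec.take++drop≡id N w) (fill-++ x (base e) (suffix e))

-- For alphabets of at most one letter, in which `marker` does not have its two letters.
trivialSparse : ∀ {n} k g → (∀ (x y : Fin n) → x ≡ y) → SparseHalesJewett n k g
trivialSparse k g equal = record
  { length        = 1
  ; count         = 1
  ; line          = λ _ → nothing ∷ []
  ; hasVariable   = λ _ → here refl
  ; monochromatic = λ f → zero , λ x y → cong (λ z → f (z ∷ [])) (equal x y)
  ; girth         = λ { (start _ _ p≢p) → contradiction refl p≢p
                      ; (extend {q = x ∷ []} {r = y ∷ []} _ _ _ _ q≢r) → contradiction (cong (_∷ []) (equal x y)) q≢r }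
  }

plainHalesJewett : ∀ {n k N} → (∀ (f : Vec (Fin n) N → Fin k) → MonochromaticLine f) →
                   SparseHalesJewett n k 1
plainHalesJewett {n} {k} {N} hj = record
  { count         = List.length ls
  ; line          = List.lookup ls
  ; hasVariable   = lines-haveVariable n N
  ; monochromatic = λ f → mono f (hj f)
  ; girth         = 1≤length
  }
  where
  ls = lines n N
  mono : ∀ f → MonochromaticLine f → ∃[ e ] Monochromatic f (List.lookup ls e)
  mono f (t , v , m) = AnyL.index (∈-lines v) , subst (Monochromatic f) (AnyL.lookup-index (∈-lines v)) m

-- Induction on `j` for all alphabets at once: girth `2 ^ j` over the alphabets of suffixes yields
-- girth `2 * 2 ^ j`. Girth 1 holds of any set of lines, so the start is the plain theorem.
sparse-hales-jewett : ∀ j n k → SparseHalesJewett n k (2 ^ j)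
sparse-hales-jewett j 0 k = trivialSparse k (2 ^ j) λ ()
sparse-hales-jewett j 1 k = trivialSparse k (2 ^ j) λ { zero zero → refl }
sparse-hales-jewett zero (suc (suc n)) k = plainHalesJewett (proj₂ (hales-jewett (suc n) k))
sparse-hales-jewett (suc j) (suc (suc n)) k =
  fromStage (amalgamateAll ℕ.≤-refl (λ m → sparse-hales-jewett j m k) _
    (initial (proj₂ (hales-jewett (suc n) k)) (2 ^ suc j)))

-- Particles in the plane

-- Expresses genericity of a parameter: finitely many such conditions hold together from some value
-- on, and that value is then chosen.
Eventually : (ℕ → Set) → Set
Eventually P = ∃[ N ] (∀ t → N ≤ t → P t)

always : ∀ {P : ℕ → Set} → (∀ t → P t) → Eventually P
always p = 0 , λ t _ → p t

_∩ᵉ_ : ∀ {P Q : ℕ → Set} → Eventually P → Eventually Q → Eventually (λ t → P t × Q t)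
(M , p) ∩ᵉ (N , q) = M ⊔ N , λ t le → p t (ℕ.m⊔n≤o⇒m≤o M N le) , q t (ℕ.m⊔n≤o⇒n≤o M N le)

eventually-⇒ : ∀ {P Q : ℕ → Set} → (∀ t → P t → Q t) → Eventually P → Eventually Q
eventually-⇒ imp (N , p) = N , λ t le → imp t (p t le)

eventually-∀ : ∀ {n} {P : Fin n → ℕ → Set} → (∀ i → Eventually (P i)) → Eventually (λ t → ∀ i → P i t)
eventually-∀ {zero}  p = always λ t ()
eventually-∀ {suc n} p = eventually-⇒ (λ { t (q , r) zero → q ; t (q , r) (suc i) → r i })
  (p zero ∩ᵉ eventually-∀ (p ∘ suc))

eventually-∀ʷ : ∀ {n N} {P : Vec (Fin n) N → ℕ → Set} →
                (∀ w → Eventually (P w)) → Eventually (λ t → ∀ w → P w t)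
eventually-∀ʷ {N = zero}  p = eventually-⇒ (λ { t q [] → q }) (p [])
eventually-∀ʷ {N = suc N} p = eventually-⇒ (λ { t q (x ∷ w) → q x w })
  (eventually-∀ λ x → eventually-∀ʷ λ w → p (x ∷ w))

eventually-given : ∀ {A : Set} {P : ℕ → Set} → Dec A → (A → Eventually P) → Eventually (λ t → A → P t)
eventually-given (yes a) p = eventually-⇒ (λ _ q _ → q) (p a)
eventually-given (no ¬a) p = always λ _ a → contradiction a ¬a

-- A root satisfies t ≤ ∣b t∣ = ∣a∣, so every `t` from ∣a∣ + 1 on will do.
eventually-≢0 : ∀ a {b} → b ≢ 0ℤ → Eventually (λ t → a ℤ.+ b ℤ.* + t ≢ 0ℤ)
eventually-≢0 a {b} b≢0 = suc ℤ.∣ a ∣ , λ t le eq → ℕ.<⇒≱ le (bound t eq)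
  where
  bound : ∀ t → a ℤ.+ b ℤ.* + t ≡ 0ℤ → t ≤ ℤ.∣ a ∣
  bound t eq = begin
    t                          ≤⟨ ℕ.m≤n*m t ℤ.∣ b ∣ {{≢-nonZero (b≢0 ∘ ℤ.∣i∣≡0⇒i≡0)}} ⟩
    ℤ.∣ b ∣ * t                ≡⟨ ℤ.abs-* b (+ t) ⟨
    ℤ.∣ b ℤ.* + t ∣            ≡⟨ ℤ.∣-i∣≡∣i∣ (b ℤ.* + t) ⟨
    ℤ.∣ ℤ.- (b ℤ.* + t) ∣      ≡⟨ cong ℤ.∣_∣ (sym (move a (b ℤ.* + t) eq)) ⟩
    ℤ.∣ a ∣                    ∎
    where
    open ℕ.≤-Reasoning
    move : ∀ x y → x ℤ.+ y ≡ 0ℤ → x ≡ ℤ.- y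
    move x y eq = trans (ring x y) (trans (cong (ℤ._+ ℤ.- y) eq) (ℤ.+-identityˡ _))
      where
      ring : ∀ x y → x ≡ (x ℤ.+ y) ℤ.+ ℤ.- y
      ring = ℤ.solve-∀

-- Without eta the operations below do not unfold on variables.
record ℤ² : Set where
  no-eta-equality
  pattern
  constructor ⟨_,_⟩
  field
    xcoord ycoord : ℤ

open ℤ² public

infixl 6 _⊕_ _⊖_
infixr 7 _•_
infix 5 _∧_

_⊕_ _⊖_ : ℤ² → ℤ² → ℤ²
⟨ a , b ⟩ ⊕ ⟨ c , d ⟩ = ⟨ a ℤ.+ c , b ℤ.+ d ⟩
⟨ a , b ⟩ ⊖ ⟨ c , d ⟩ = ⟨ a ℤ.- c , b ℤ.- d ⟩

_•_ : ℤ → ℤ² → ℤ²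
t • ⟨ a , b ⟩ = ⟨ t ℤ.* a , t ℤ.* b ⟩

_∧_ : ℤ² → ℤ² → ℤ
⟨ a , b ⟩ ∧ ⟨ c , d ⟩ = a ℤ.* d ℤ.- b ℤ.* c

0² : ℤ²
0² = ⟨ 0ℤ , 0ℤ ⟩

_≟²_ : DecidableEquality ℤ²
⟨ a , b ⟩ ≟² ⟨ c , d ⟩ = map′ (λ (p , q) → cong₂ ⟨_,_⟩ p q) (λ { refl → refl , refl }) (a ℤ.≟ c ×-dec b ℤ.≟ d)

ycoord-⊕ : ∀ u v → ycoord (u ⊕ v) ≡ ycoord u ℤ.+ ycoord v
ycoord-⊕ ⟨ _ , _ ⟩ ⟨ _ , _ ⟩ = refl

⊖-self : ∀ u → u ⊖ u ≡ 0²
⊖-self ⟨ a , b ⟩ = cong₂ ⟨_,_⟩ (ℤ.+-inverseʳ a) (ℤ.+-inverseʳ b)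

⊖≡0⇒≡ : ∀ u v → u ⊖ v ≡ 0² → u ≡ v
⊖≡0⇒≡ ⟨ a , b ⟩ ⟨ c , d ⟩ eq = cong₂ ⟨_,_⟩
  (ℤ.i-j≡0⇒i≡j a c (cong xcoord eq)) (ℤ.i-j≡0⇒i≡j b d (cong ycoord eq))

∧-self : ∀ u v → (u ⊖ u ∧ v) ≡ 0ℤ
∧-self ⟨ a , b ⟩ ⟨ c , d ⟩ = ring a b c d
  where
  ring : ∀ a b c d → (a ℤ.- a) ℤ.* d ℤ.- (b ℤ.- b) ℤ.* c ≡ 0ℤ
  ring = ℤ.solve-∀

∧≢0⇒≢ : ∀ {u v w} → (u ⊖ v ∧ w) ≢ 0ℤ → u ≢ v
∧≢0⇒≢ {u} {w = w} ne refl = ne (∧-self u w)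

-- A particle moving in the plane with velocity δ, at β at time 0.
Meet : (δ β δ′ β′ : ℤ²) → Set
Meet δ β δ′ β′ = δ ≢ δ′ × (β ⊖ β′ ∧ δ ⊖ δ′) ≡ 0ℤ

Meet-sym : ∀ {δ β δ′ β′} → Meet δ β δ′ β′ → Meet δ′ β′ δ β
Meet-sym {⟨ a , b ⟩} {⟨ c , d ⟩} {⟨ a′ , b′ ⟩} {⟨ c′ , d′ ⟩} (ne , eq) = ≢-sym ne , trans (ring a b c d a′ b′ c′ d′) eq
  where
  ring : ∀ a b c d a′ b′ c′ d′ → (c′ ℤ.- c) ℤ.* (b′ ℤ.- b) ℤ.- (d′ ℤ.- d) ℤ.* (a′ ℤ.- a)
                             ≡ (c ℤ.- c′) ℤ.* (b ℤ.- b′) ℤ.- (d ℤ.- d′) ℤ.* (a ℤ.- a′)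
  ring = ℤ.solve-∀

-- The collision graph is kept in incidence form, so that `Girth≥` and `Amalgam` treat it like a set
-- of combinatorial lines. Distinct initial positions ensure that particles of equal velocity have
-- disjoint world lines.
record Arrangement (V : Set) (g k : ℕ) : Set₁ where
  field
    Edge       : Set
    src tgt    : Edge → V
    δ β        : V → ℤ²
    β-injective : ∀ {u v} → β u ≡ β v → u ≡ v

  Incident : V → Edge → Set
  Incident v e = v ≡ src e ⊎ v ≡ tgt e

  field
    meet⇒edge  : ∀ {u v} → Meet (δ u) (β u) (δ v) (β v) → ∃[ e ] (Incident u e × Incident v e)
    edge⇒meet  : ∀ e → Meet (δ (src e)) (β (src e)) (δ (tgt e)) (β (tgt e))
    girth      : Girth≥ Incident g
    uncolourable : ∀ (f : V → Fin k) → ∃[ e ] f (src e) ≡ f (tgt e)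

reindex : ∀ {V W g k} (to : V → W) (from : W → V) → (∀ v → from (to v) ≡ v) → (∀ w → to (from w) ≡ w) →
          Arrangement V g k → Arrangement W g k
reindex {g = g} to from from-to to-from A = record
  { Edge         = Edge
  ; src          = to ∘ src
  ; tgt          = to ∘ tgt
  ; δ            = δ ∘ from
  ; β            = β ∘ from
  ; β-injective  = λ eq → from-injective (β-injective eq)
  ; meet⇒edge    = λ m → let e , u∈ , v∈ = meet⇒edge m in e , back u∈ , back v∈
  ; edge⇒meet    = λ e → subst₂ (λ u v → Meet (δ u) (β u) (δ v) (β v))
                           (sym (from-to (src e))) (sym (from-to (tgt e))) (edge⇒meet e)
  ; girth        = λ w → girth (mapWalk from (λ e → e) forth (λ _ _ → from-injective) (λ eq → eq) w)
  ; uncolourable = uncolourable ∘ (_∘ to)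
  }
  where
  open Arrangement A
  from-injective : ∀ {x y} → from x ≡ from y → x ≡ y
  from-injective eq = trans (sym (to-from _)) (trans (cong to eq) (to-from _))
  back : ∀ {w e} → Incident (from w) e → w ≡ to (src e) ⊎ w ≡ to (tgt e)
  back (inj₁ eq) = inj₁ (trans (sym (to-from _)) (cong to eq))
  back (inj₂ eq) = inj₂ (trans (sym (to-from _)) (cong to eq))
  forth : ∀ {w e} → w ≡ to (src e) ⊎ w ≡ to (tgt e) → Incident (from w) e
  forth (inj₁ eq) = inj₁ (trans (cong from eq) (from-to _))
  forth (inj₂ eq) = inj₂ (trans (cong from eq) (from-to _))

-- The determinant is linear in `t` with slope -D₂. If D₂ = 0 it is the constant D₁ (b + s), which
-- is why `s` is chosen before `t`.
eventually-transverse : ∀ {D} v {s} → D ≢ 0² → ycoord v ℤ.+ s ≢ 0ℤ →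
                        Eventually (λ t → (D ∧ v ⊕ ⟨ + t , s ⟩) ≢ 0ℤ)
eventually-transverse {⟨ D₁ , D₂ ⟩} ⟨ a , b ⟩ {s} D≢0 b+s≢0 with D₂ ℤ.≟ 0ℤ
... | no D₂≢0 = eventually-⇒ (λ t ne eq → ne (trans (ring D₁ D₂ a (b ℤ.+ s) (+ t)) eq))
    (eventually-≢0 (D₁ ℤ.* (b ℤ.+ s) ℤ.- D₂ ℤ.* a) (D₂≢0 ∘ ℤ.neg-injective))
  where
  ring : ∀ D₁ D₂ x y t → D₁ ℤ.* y ℤ.- D₂ ℤ.* x ℤ.+ ℤ.- D₂ ℤ.* t ≡ D₁ ℤ.* y ℤ.- D₂ ℤ.* (x ℤ.+ t)
  ring = ℤ.solve-∀
... | yes refl = always nonzero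
  where
  nonzero : ∀ t → D₁ ℤ.* (b ℤ.+ s) ℤ.- 0ℤ ℤ.* (a ℤ.+ + t) ≢ 0ℤ
  nonzero t eq with ℤ.i*j≡0⇒i≡0∨j≡0 D₁ (trans (sym (ℤ.+-identityʳ _)) eq)
  ... | inj₁ D₁≡0  = D≢0 (cong ⟨_, 0ℤ ⟩ D₁≡0)
  ... | inj₂ b+s≡0 = b+s≢0 b+s≡0

-- Adding one velocity to all particles preserves their mutual collisions. `separated` will keep the
-- moving particles away from foreign words, `transverse` will make delays affect the collisions
-- between copies, and `d₂≢0` will tell apart delayed particles of equal velocity.
record Boost {n : ℕ} (δ β : Fin n → ℤ²) : Set where
  field
    boost : ℤ²
  d : Fin n → ℤ²
  d i = δ i ⊕ boost
  field
    d₂≢0       : ∀ i → ycoord (d i) ≢ 0ℤ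
    separated  : ∀ {a b} i → a ≢ b → (β a ⊖ β b ∧ d i) ≢ 0ℤ
    transverse : ∀ {a b} → δ a ≢ δ b → (d a ∧ d b) ≢ 0ℤ

-- Brings `transverse` into the form of `eventually-transverse`: subtracting the right factor from
-- the left one does not change a determinant.
∧-difference : ∀ u v w → (u ⊖ v ∧ v ⊕ w) ≡ (u ⊕ w ∧ v ⊕ w)
∧-difference ⟨ a , b ⟩ ⟨ c , d ⟩ ⟨ e , f ⟩ = ring a b c d e f
  where
  ring : ∀ a b c d e f → (a ℤ.- c) ℤ.* (d ℤ.+ f) ℤ.- (b ℤ.- d) ℤ.* (c ℤ.+ e) ≡
                         (a ℤ.+ e) ℤ.* (d ℤ.+ f) ℤ.- (b ℤ.+ f) ℤ.* (c ℤ.+ e)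
  ring = ℤ.solve-∀

findBoost : ∀ {n} (δ β : Fin n → ℤ²) → (∀ {u v} → β u ≡ β v → u ≡ v) → Boost δ β
findBoost {n} δ β β-inj = record
  { boost      = ⟨ + t , + s ⟩
  ; d₂≢0       = λ i → d₂≢0 i ∘ trans (sym (ycoord-⊕ (δ i) ⟨ + t , + s ⟩))
  ; separated  = λ {a} {b} i a≢b → proj₁ (generic a b i) a≢b
  ; transverse = λ {a} {b} ne eq → proj₂ (generic a b b) ne (trans (∧-difference (δ a) (δ b) ⟨ + t , + s ⟩) eq)
  }
  where
  E₁ : Eventually (λ s → ∀ i → ycoord (δ i) ℤ.+ + s ≢ 0ℤ)
  E₁ = eventually-∀ λ i → eventually-⇒
    (λ t ne eq → ne (trans (cong (λ z → ycoord (δ i) ℤ.+ z) (ℤ.*-identityˡ (+ t))) eq))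
    (eventually-≢0 (ycoord (δ i)) {1ℤ} λ ())
  s = proj₁ E₁
  d₂≢0 : ∀ i → ycoord (δ i) ℤ.+ + s ≢ 0ℤ
  d₂≢0 = proj₂ E₁ s ℕ.≤-refl
  E₂ : Eventually (λ t → ∀ a b i → (a ≢ b → (β a ⊖ β b ∧ δ i ⊕ ⟨ + t , + s ⟩) ≢ 0ℤ) ×
                                   (δ a ≢ δ b → (δ a ⊖ δ b ∧ δ i ⊕ ⟨ + t , + s ⟩) ≢ 0ℤ))
  E₂ = eventually-∀ λ a → eventually-∀ λ b → eventually-∀ λ i →
    eventually-given (¬? (a Fin.≟ b)) (λ ne → eventually-transverse (δ i) (ne ∘ β-inj ∘ ⊖≡0⇒≡ _ _) (d₂≢0 i))
    ∩ᵉ eventually-given (¬? (δ a ≟² δ b)) (λ ne → eventually-transverse (δ i) (ne ∘ ⊖≡0⇒≡ _ _) (d₂≢0 i))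
  t = proj₁ E₂
  generic = proj₂ E₂ t ℕ.≤-refl

-- Positions of words in the plane

module _ {n : ℕ} (β : Fin n → ℤ²) where

  position : ∀ {N} → Vec ℤ N → Vec (Fin n) N → ℤ²
  position []      []      = 0²
  position (μ ∷ μs) (x ∷ w) = μ • β x ⊕ position μs w

  ∧-position : ∀ t x p y q d → (t • x ⊕ p ⊖ (t • y ⊕ q) ∧ d) ≡ (p ⊖ q ∧ d) ℤ.+ (x ⊖ y ∧ d) ℤ.* t
  ∧-position t ⟨ x , x′ ⟩ ⟨ p , p′ ⟩ ⟨ y , y′ ⟩ ⟨ q , q′ ⟩ ⟨ d , d′ ⟩ = ring t x x′ p p′ y y′ q q′ d d′
    where
    ring : ∀ t x x′ p p′ y y′ q q′ d d′ →
      (t ℤ.* x ℤ.+ p ℤ.- (t ℤ.* y ℤ.+ q)) ℤ.* d′ ℤ.- (t ℤ.* x′ ℤ.+ p′ ℤ.- (t ℤ.* y′ ℤ.+ q′)) ℤ.* d ≡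
      ((p ℤ.- q) ℤ.* d′ ℤ.- (p′ ℤ.- q′) ℤ.* d) ℤ.+ ((x ℤ.- y) ℤ.* d′ ℤ.- (x′ ℤ.- y′) ℤ.* d) ℤ.* t
    ring = ℤ.solve-∀

  -- The weights are chosen one at a time. For different first letters `x`, `y` the determinant is
  -- linear in the new weight, with the non-zero slope `β x ⊖ β y ∧ d i`; equal first letters cancel
  -- and leave the induction hypothesis.
  findWeights : ∀ {m} (d : Fin m → ℤ²) → (∀ {a b} i → a ≢ b → (β a ⊖ β b ∧ d i) ≢ 0ℤ) → ∀ N →
                Σ[ μ ∈ Vec ℤ N ] (∀ v w i → v ≢ w → (position μ v ⊖ position μ w ∧ d i) ≢ 0ℤ)
  findWeights d sep zero    = [] , λ { [] [] i ne → contradiction refl ne }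
  findWeights d sep (suc N) with findWeights d sep N
  ... | μ , ih = + proj₁ E ∷ μ , λ { (x ∷ v) (y ∷ w) → proj₂ E (proj₁ E) ℕ.≤-refl x y v w }
    where
    E : Eventually (λ t → ∀ x y v w i → x ∷ v ≢ y ∷ w → (position (+ t ∷ μ) (x ∷ v) ⊖ position (+ t ∷ μ) (y ∷ w) ∧ d i) ≢ 0ℤ)
    E = eventually-∀ λ x → eventually-∀ λ y → eventually-∀ʷ λ v → eventually-∀ʷ λ w → eventually-∀ λ i →
        eventually-given (¬? (Vec.≡-dec Fin._≟_ (x ∷ v) (y ∷ w))) (separate x y v w i)
      where
      separate : ∀ x y v w i → x ∷ v ≢ y ∷ w →
        Eventually (λ t → (position (+ t ∷ μ) (x ∷ v) ⊖ position (+ t ∷ μ) (y ∷ w) ∧ d i) ≢ 0ℤ)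
      separate x y v w i ne with x Fin.≟ y
      ... | no x≢y = eventually-⇒ (λ t ne eq → ne (trans (sym (∧-position (+ t) (β x) (position μ v) (β y) _ (d i))) eq))
                       (eventually-≢0 (position μ v ⊖ position μ w ∧ d i) (sep i x≢y))
      ... | yes refl = always λ t eq → ih v w i (λ v≡w → ne (cong (x ∷_) v≡w))
              (trans (sym (trans (cong (λ z → (position μ v ⊖ position μ w ∧ d i) ℤ.+ z ℤ.* + t) (∧-self (β x) (d i))) (ℤ.+-identityʳ _)))
                (trans (sym (∧-position (+ t) (β x) (position μ v) (β x) (position μ w) (d i))) eq))

  scale : ∀ {N} → Vec ℤ N → Template (Fin n) N → ℤ
  scale []      []            = 0ℤ
  scale (μ ∷ μs) (just _ ∷ t)  = scale μs t
  scale (μ ∷ μs) (nothing ∷ t) = μ ℤ.+ scale μs t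

  -- A combinatorial line is positioned as a homothetic copy of β.
  position-fill : ∀ {N} (μ : Vec ℤ N) t a b →
                  position μ (fill a t) ⊖ position μ (fill b t) ≡ scale μ t • (β a ⊖ β b)
  position-fill []      []            a b = zero-scale (β a ⊖ β b)
    where
    zero-scale : ∀ u → 0² ⊖ 0² ≡ 0ℤ • u
    zero-scale ⟨ _ , _ ⟩ = refl
  position-fill (μ ∷ μs) (just x ∷ t)  a b = trans (drop (μ • β x) (position μs (fill a t)) (position μs (fill b t))) (position-fill μs t a b)
    where
    drop : ∀ u v w → u ⊕ v ⊖ (u ⊕ w) ≡ v ⊖ w
    drop ⟨ u , u′ ⟩ ⟨ v , v′ ⟩ ⟨ w , w′ ⟩ = cong₂ ⟨_,_⟩ (ring u v w) (ring u′ v′ w′)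
      where
      ring : ∀ u v w → u ℤ.+ v ℤ.- (u ℤ.+ w) ≡ v ℤ.- w
      ring = ℤ.solve-∀
  position-fill (μ ∷ μs) (nothing ∷ t) a b =
    trans (collect μ (β a) (β b) (position μs (fill a t)) (position μs (fill b t)))
      (trans (cong (μ • (β a ⊖ β b) ⊕_) (position-fill μs t a b)) (distrib μ (scale μs t) (β a ⊖ β b)))
    where
    collect : ∀ μ a b p q → μ • a ⊕ p ⊖ (μ • b ⊕ q) ≡ μ • (a ⊖ b) ⊕ (p ⊖ q)
    collect μ ⟨ a , a′ ⟩ ⟨ b , b′ ⟩ ⟨ p , p′ ⟩ ⟨ q , q′ ⟩ = cong₂ ⟨_,_⟩ (ring μ a b p q) (ring μ a′ b′ p′ q′)
      where
      ring : ∀ μ a b p q → μ ℤ.* a ℤ.+ p ℤ.- (μ ℤ.* b ℤ.+ q) ≡ μ ℤ.* (a ℤ.- b) ℤ.+ (p ℤ.- q)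
      ring = ℤ.solve-∀
    distrib : ∀ μ ν u → μ • u ⊕ ν • u ≡ (μ ℤ.+ ν) • u
    distrib μ ν ⟨ a , b ⟩ = sym (cong₂ ⟨_,_⟩ (ℤ.*-distribʳ-+ a μ ν) (ℤ.*-distribʳ-+ b μ ν))

-- The Tutte–Zykov construction

module _ {V E : Set} (I : V → E → Set) where

  -- I with a pendant vertex inj₁ v attached to every vertex inj₂ v.
  Pendant : V ⊎ V → E ⊎ V → Set
  Pendant (inj₁ v) (inj₁ e) = ⊥
  Pendant (inj₁ v) (inj₂ u) = v ≡ u
  Pendant (inj₂ v) (inj₁ e) = I v e
  Pendant (inj₂ v) (inj₂ u) = v ≡ u

  private
    base : V ⊎ V → V
    base (inj₁ v) = v
    base (inj₂ v) = v

    -- A walk can use a pendant edge only as its first or last edge.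
    data Reached (p : V ⊎ V) : E ⊎ V → V ⊎ V → ℕ → Set where
      leave  : ∀ {v n} → p ≡ inj₁ v → Reached p (inj₂ v) (inj₂ v) (suc n)
      inside : ∀ {e v m n} → m ≤ n → Walk I (base p) e v m → Reached p (inj₁ e) (inj₂ v) n
      stop₁  : ∀ {v n} → p ≡ inj₂ v → Reached p (inj₂ v) (inj₁ v) n
      stop₂  : ∀ {e v m n} → m ≤ n → Walk I (base p) e v m → Reached p (inj₂ v) (inj₁ v) n

    reach : ∀ {p e q n} → Walk Pendant p e q n → Reached p e q n
    reach {inj₁ _} {inj₂ _} {inj₁ _} (start refl refl p≢q) = contradiction refl p≢q
    reach {inj₁ _} {inj₂ _} {inj₂ _} (start refl refl _)   = leave refl
    reach {inj₂ _} {inj₁ _} {inj₂ _} (start p∈ q∈ p≢q)     = inside ℕ.≤-refl (start p∈ q∈ (p≢q ∘ cong inj₂))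
    reach {inj₂ _} {inj₂ _} {inj₁ _} (start refl refl _)   = stop₁ refl
    reach {inj₂ _} {inj₂ _} {inj₂ _} (start refl refl p≢q) = contradiction refl p≢q
    reach (extend {f = f} {r = r} w e≢f q∈ r∈ q≢r) with reach w
    reach (extend {f = inj₁ _} {inj₂ _} w e≢f q∈ r∈ q≢r) | leave refl = inside (s≤s z≤n) (start q∈ r∈ (q≢r ∘ cong inj₂))
    reach (extend {f = inj₂ _} {_}      w e≢f refl r∈ q≢r) | leave refl = contradiction refl e≢f
    reach (extend {f = inj₁ _} {inj₂ _} w e≢f q∈ r∈ q≢r) | inside m≤n w′ =
      inside (s≤s m≤n) (extend w′ (e≢f ∘ cong inj₁) q∈ r∈ (q≢r ∘ cong inj₂))
    reach (extend {f = inj₂ _} {inj₁ _} w e≢f refl refl q≢r) | inside m≤n w′ = stop₂ (ℕ.m≤n⇒m≤1+n m≤n) w′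
    reach (extend {f = inj₂ _} {inj₂ _} w e≢f refl refl q≢r) | inside m≤n w′ = contradiction refl q≢r
    reach (extend {f = inj₂ _} w e≢f refl r∈ q≢r) | stop₁ _ = contradiction refl e≢f
    reach (extend {f = inj₂ _} w e≢f refl r∈ q≢r) | stop₂ _ _ = contradiction refl e≢f

  -- Removing the pendant edges at its ends turns a closed walk into a closed walk of `I`.
  pendant-girth : ∀ {g} → Girth≥ I g → Girth≥ Pendant g
  pendant-girth gI {inj₁ _} w with reach w
  ... | stop₂ m≤n w′  = ℕ.≤-trans (gI w′) m≤n
  pendant-girth gI {inj₂ _} w with reach w
  ... | inside m≤n w′ = ℕ.≤-trans (gI w′) m≤n

-- The collision determinant of two delayed particles is linear in `s`. Its slope is non-zero when
-- the delay factors differ and the velocities are not parallel.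
∧-motions : ∀ p q u v x y s → (p ⊕ (x ℤ.* s) • u ⊖ (q ⊕ (y ℤ.* s) • v) ∧ u ⊖ v) ≡
                              (p ⊖ q ∧ u ⊖ v) ℤ.+ ((y ℤ.- x) ℤ.* (u ∧ v)) ℤ.* s
∧-motions ⟨ p , p′ ⟩ ⟨ q , q′ ⟩ ⟨ u , u′ ⟩ ⟨ v , v′ ⟩ x y s = ring p p′ q q′ u u′ v v′ x y s
  where
  ring : ∀ p p′ q q′ u u′ v v′ x y s →
    (p ℤ.+ x ℤ.* s ℤ.* u ℤ.- (q ℤ.+ y ℤ.* s ℤ.* v)) ℤ.* (u′ ℤ.- v′) ℤ.-
    (p′ ℤ.+ x ℤ.* s ℤ.* u′ ℤ.- (q′ ℤ.+ y ℤ.* s ℤ.* v′)) ℤ.* (u ℤ.- v) ≡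
    ((p ℤ.- q) ℤ.* (u′ ℤ.- v′) ℤ.- (p′ ℤ.- q′) ℤ.* (u ℤ.- v)) ℤ.+ ((y ℤ.- x) ℤ.* (u ℤ.* v′ ℤ.- u′ ℤ.* v)) ℤ.* s
  ring = ℤ.solve-∀

-- Against `v` the motion of the second particle drops out, so the slope can be non-zero even for
-- equal delay factors.
∧-motions′ : ∀ p q u v x y s → (p ⊕ (x ℤ.* s) • u ⊖ (q ⊕ (y ℤ.* s) • v) ∧ v) ≡
                               (p ⊖ q ∧ v) ℤ.+ (x ℤ.* (u ∧ v)) ℤ.* s
∧-motions′ ⟨ p , p′ ⟩ ⟨ q , q′ ⟩ ⟨ u , u′ ⟩ ⟨ v , v′ ⟩ x y s = ring p p′ q q′ u u′ v v′ x y s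
  where
  ring : ∀ p p′ q q′ u u′ v v′ x y s →
    (p ℤ.+ x ℤ.* s ℤ.* u ℤ.- (q ℤ.+ y ℤ.* s ℤ.* v)) ℤ.* v′ ℤ.-
    (p′ ℤ.+ x ℤ.* s ℤ.* u′ ℤ.- (q′ ℤ.+ y ℤ.* s ℤ.* v′)) ℤ.* v ≡
    ((p ℤ.- q) ℤ.* v′ ℤ.- (p′ ℤ.- q′) ℤ.* v) ℤ.+ (x ℤ.* (u ℤ.* v′ ℤ.- u′ ℤ.* v)) ℤ.* s
  ring = ℤ.solve-∀

-- A delay shifts a particle along its own path and so does not affect which resting points it
-- passes through.
∧-motion-rest : ∀ p q u c → (p ⊖ (q ⊕ c • u) ∧ 0² ⊖ u) ≡ ℤ.- (p ⊖ q ∧ u)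
∧-motion-rest ⟨ p , p′ ⟩ ⟨ q , q′ ⟩ ⟨ u , u′ ⟩ c = ring p p′ q q′ u u′ c
  where
  ring : ∀ p p′ q q′ u u′ c →
    (p ℤ.- (q ℤ.+ c ℤ.* u)) ℤ.* (0ℤ ℤ.- u′) ℤ.- (p′ ℤ.- (q′ ℤ.+ c ℤ.* u′)) ℤ.* (0ℤ ℤ.- u) ≡
    ℤ.- ((p ℤ.- q) ℤ.* u′ ℤ.- (p′ ℤ.- q′) ℤ.* u)
  ring = ℤ.solve-∀

∧-drift : ∀ p q u c → (p ⊖ (q ⊕ c • u) ∧ u) ≡ (p ⊖ q ∧ u)
∧-drift ⟨ p , p′ ⟩ ⟨ q , q′ ⟩ ⟨ u , u′ ⟩ c = ring p p′ q q′ u u′ c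
  where
  ring : ∀ p p′ q q′ u u′ c →
    (p ℤ.- (q ℤ.+ c ℤ.* u)) ℤ.* u′ ℤ.- (p′ ℤ.- (q′ ℤ.+ c ℤ.* u′)) ℤ.* u ≡
    (p ℤ.- q) ℤ.* u′ ℤ.- (p′ ℤ.- q′) ℤ.* u
  ring = ℤ.solve-∀

•-∧ : ∀ c u v → (c • u ∧ v) ≡ c ℤ.* (u ∧ v)
•-∧ c ⟨ u , u′ ⟩ ⟨ v , v′ ⟩ = ring c u u′ v v′
  where
  ring : ∀ c u u′ v v′ → c ℤ.* u ℤ.* v′ ℤ.- c ℤ.* u′ ℤ.* v ≡ c ℤ.* (u ℤ.* v′ ℤ.- u′ ℤ.* v)
  ring = ℤ.solve-∀

⊕-⊖-cancel : ∀ u v w → u ⊕ w ⊖ (v ⊕ w) ≡ u ⊖ v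
⊕-⊖-cancel ⟨ u , u′ ⟩ ⟨ v , v′ ⟩ ⟨ w , w′ ⟩ = cong₂ ⟨_,_⟩ (ring u v w) (ring u′ v′ w′)
  where
  ring : ∀ u v w → u ℤ.+ w ℤ.- (v ℤ.+ w) ≡ u ℤ.- v
  ring = ℤ.solve-∀

ycoord-⊖-motions : ∀ p q u x y s → ycoord (p ⊕ (x ℤ.* s) • u ⊖ (q ⊕ (y ℤ.* s) • u)) ≡
                                   ycoord p ℤ.- ycoord q ℤ.+ ((x ℤ.- y) ℤ.* ycoord u) ℤ.* s
ycoord-⊖-motions ⟨ _ , p ⟩ ⟨ _ , q ⟩ ⟨ _ , u ⟩ x y s = ring p q u x y s
  where
  ring : ∀ p q u x y s → p ℤ.+ x ℤ.* s ℤ.* u ℤ.- (q ℤ.+ y ℤ.* s ℤ.* u) ≡ p ℤ.- q ℤ.+ ((x ℤ.- y) ℤ.* u) ℤ.* s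
  ring = ℤ.solve-∀

ycoord-⊖-motion : ∀ p u x s → ycoord (p ⊖ (p ⊕ (x ℤ.* s) • u)) ≡ 0ℤ ℤ.+ (ℤ.- x ℤ.* ycoord u) ℤ.* s
ycoord-⊖-motion ⟨ _ , p ⟩ ⟨ _ , u ⟩ x s = ring p u x s
  where
  ring : ∀ p u x s → p ℤ.- (p ℤ.+ x ℤ.* s ℤ.* u) ≡ 0ℤ ℤ.+ (ℤ.- x ℤ.* u) ℤ.* s
  ring = ℤ.solve-∀

⊕-cancelʳ : ∀ u v w → u ⊕ w ≡ v ⊕ w → u ≡ v
⊕-cancelʳ u v w eq = ⊖≡0⇒≡ u v (trans (sym (⊕-⊖-cancel u v w)) (trans (cong (_⊖ (v ⊕ w)) eq) (⊖-self (v ⊕ w))))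

i-j≢0 : ∀ {i j} → i ≢ j → i ℤ.- j ≢ 0ℤ
i-j≢0 {i} {j} ne eq = ne (ℤ.i-j≡0⇒i≡j i j eq)

*-≢0 : ∀ {i j} → i ≢ 0ℤ → j ≢ 0ℤ → i ℤ.* j ≢ 0ℤ
*-≢0 {i} i≢0 j≢0 eq with ℤ.i*j≡0⇒i≡0∨j≡0 i eq
... | inj₁ i≡0 = i≢0 i≡0
... | inj₂ j≡0 = j≢0 j≡0

punchOut-injective′ : ∀ {n} {i i′ j k : Fin (suc n)} (i≢j : i ≢ j) (i′≢k : i′ ≢ k) → i ≡ i′ →
                      Fin.punchOut i≢j ≡ Fin.punchOut i′≢k → j ≡ k
punchOut-injective′ i≢j i≢k refl = Fin.punchOut-injective i≢j i≢k

-- The words of H rest, and each line e of H is accompanied by a homothetic copy of the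
-- boosted particles of A, the i-th of which passes through the i-th point of e, delayed
-- by κ e · s.
module _ {n g k : ℕ} (A : Arrangement (Fin n) g k)
         {h : ℕ} (H : SparseHalesJewett n (suc k) h) where

  private
    open Arrangement A
    module H = SparseHalesJewett H

  module Delayed (B : Boost δ β) (μ : Vec ℤ H.length)
                 (apart : ∀ v w i → v ≢ w → (position β μ v ⊖ position β μ w ∧ Boost.d B i) ≢ 0ℤ)
                 (κ : Fin H.count → ℤ) (κ≢0 : ∀ e → κ e ≢ 0ℤ) (κ-injective : ∀ {e f} → κ e ≡ κ f → e ≡ f)
    where

    open Boost B

    Word V′ E′ : Set
    Word = Vec (Fin n) H.length
    V′ = Word ⊎ (Fin H.count × Fin n)
    E′ = Fin H.count × (Edge ⊎ Fin n)

    pos : Word → ℤ²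
    pos = position β μ

    point : Fin H.count → Fin n → Word
    point e i = fill i (H.line e)

    delayed : ℕ → Fin H.count → Fin n → ℤ²
    delayed s e i = pos (point e i) ⊕ (κ e ℤ.* + s) • d i

    κ-≢ : ∀ {e f} → e ≢ f → κ f ℤ.- κ e ≢ 0ℤ
    κ-≢ e≢f = i-j≢0 (e≢f ∘ sym ∘ κ-injective)

    -- `Meetless` excludes collisions between different copies. The others keep initial positions
    -- distinct: for different velocities, for equal velocities in different copies, and for a
    -- particle and its own word. Each is tested by one scalar that is linear in `s`.
    Meetless Distinct-∦ Distinct-∥ Moved : ℕ → Set
    Meetless s   = ∀ e f i j → e ≢ f × δ i ≢ δ j → (delayed s e i ⊖ delayed s f j ∧ d i ⊖ d j) ≢ 0ℤ
    Distinct-∦ s = ∀ e f i j → δ i ≢ δ j → (delayed s e i ⊖ delayed s f j ∧ d j) ≢ 0ℤ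
    Distinct-∥ s = ∀ e f i j → e ≢ f × d i ≡ d j → ycoord (delayed s e i ⊖ delayed s f j) ≢ 0ℤ
    Moved s      = ∀ e i → ycoord (pos (point e i) ⊖ delayed s e i) ≢ 0ℤ

    meetless : Eventually Meetless
    meetless = eventually-∀ λ e → eventually-∀ λ f → eventually-∀ λ i → eventually-∀ λ j →
      eventually-given (¬? (e Fin.≟ f) ×-dec ¬? (δ i ≟² δ j)) λ (e≢f , ne) →
      eventually-⇒ (λ s → _∘ trans (sym (∧-motions (pos (point e i)) (pos (point f j)) (d i) (d j) (κ e) (κ f) (+ s))))
        (eventually-≢0 (pos (point e i) ⊖ pos (point f j) ∧ d i ⊖ d j) (*-≢0 (κ-≢ e≢f) (transverse ne)))

    distinct-∦ : Eventually Distinct-∦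
    distinct-∦ = eventually-∀ λ e → eventually-∀ λ f → eventually-∀ λ i → eventually-∀ λ j →
      eventually-given (¬? (δ i ≟² δ j)) λ ne →
      eventually-⇒ (λ s → _∘ trans (sym (∧-motions′ (pos (point e i)) (pos (point f j)) (d i) (d j) (κ e) (κ f) (+ s))))
        (eventually-≢0 (pos (point e i) ⊖ pos (point f j) ∧ d j) (*-≢0 (κ≢0 e) (transverse ne)))

    distinct-∥ : Eventually Distinct-∥
    distinct-∥ = eventually-∀ λ e → eventually-∀ λ f → eventually-∀ λ i → eventually-∀ λ j →
      eventually-given (¬? (e Fin.≟ f) ×-dec (d i ≟² d j)) λ (e≢f , di≡dj) →
      eventually-⇒ (λ s → _∘ trans (sym (trans
          (cong (λ v → ycoord (delayed s e i ⊖ (pos (point f j) ⊕ (κ f ℤ.* + s) • v))) (sym di≡dj))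
          (ycoord-⊖-motions (pos (point e i)) (pos (point f j)) (d i) (κ e) (κ f) (+ s)))))
        (eventually-≢0 (ycoord (pos (point e i)) ℤ.- ycoord (pos (point f j))) (*-≢0 (κ-≢ (≢-sym e≢f)) (d₂≢0 i)))

    moved : Eventually Moved
    moved = eventually-∀ λ e → eventually-∀ λ i →
      eventually-⇒ (λ s → _∘ trans (sym (ycoord-⊖-motion (pos (point e i)) (d i) (κ e) (+ s))))
        (eventually-≢0 0ℤ (*-≢0 (κ≢0 e ∘ ℤ.neg-injective) (d₂≢0 i)))

    generic : Eventually (λ s → Meetless s × Distinct-∦ s × Distinct-∥ s × Moved s)
    generic = meetless ∩ᵉ (distinct-∦ ∩ᵉ (distinct-∥ ∩ᵉ moved))

    module _ (g≤2h : g ≤ 2 * h) (s : ℕ) (good : Meetless s × Distinct-∦ s × Distinct-∥ s × Moved s) where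

      δ′ β′ : V′ → ℤ²
      δ′ (inj₁ w)       = 0²
      δ′ (inj₂ (e , i)) = d i
      β′ (inj₁ w)       = pos w
      β′ (inj₂ (e , i)) = delayed s e i

      pos-injective : ∀ {v w} → pos v ≡ pos w → v ≡ w
      pos-injective {v} {w} eq with Vec.≡-dec Fin._≟_ v w
      ... | yes v≡w = v≡w
      -- `apart` asks for a direction; the first letter of `v` supplies one, and `v ≢ w` ensures
      -- that there is a letter.
      ... | no  v≢w = contradiction eq (∧≢0⇒≢ (apart v w (letter v w v≢w) v≢w))
        where
        letter : ∀ {N} (v w : Vec (Fin n) N) → v ≢ w → Fin n
        letter []      []      ne = contradiction refl ne
        letter (x ∷ _) (_ ∷ _) _  = x

      rest≢delayed : ∀ w e i → pos w ≢ delayed s e i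
      rest≢delayed w e i eq with Vec.≡-dec Fin._≟_ w (point e i)
      ... | yes refl = proj₂ (proj₂ (proj₂ good)) e i
                         (trans (cong (λ v → ycoord (v ⊖ delayed s e i)) eq) (cong ycoord (⊖-self (delayed s e i))))
      ... | no ne = ∧≢0⇒≢ (λ eq → apart w (point e i) i ne (trans (sym (∧-drift (pos w) (pos (point e i)) (d i) (κ e ℤ.* + s))) eq)) eq

      delayed-injective : ∀ e f i j → delayed s e i ≡ delayed s f j → (e , i) ≡ (f , j)
      delayed-injective e f i j eq with δ i ≟² δ j
      ... | no ne = contradiction eq (∧≢0⇒≢ (proj₁ (proj₂ good) e f i j ne))
      ... | yes δ≡ with e Fin.≟ f
      ...   | no e≢f = contradiction
                (trans (cong (λ v → ycoord (v ⊖ delayed s f j)) eq) (cong ycoord (⊖-self (delayed s f j))))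
                (proj₁ (proj₂ (proj₂ good)) e f i j (e≢f , cong (_⊕ boost) δ≡))
      ...   | yes refl = cong (e ,_) (fill-injective (H.hasVariable e)
                (pos-injective (⊕-cancelʳ _ _ ((κ e ℤ.* + s) • d i)
                  (trans eq (cong (λ v → pos (point e j) ⊕ (κ e ℤ.* + s) • (v ⊕ boost)) (sym δ≡))))))

      β′-injective : ∀ {u v} → β′ u ≡ β′ v → u ≡ v
      β′-injective {inj₁ v}       {inj₁ w}       eq = cong inj₁ (pos-injective eq)
      β′-injective {inj₁ v}       {inj₂ (e , i)} eq = contradiction eq (rest≢delayed v e i)
      β′-injective {inj₂ (e , i)} {inj₁ v}       eq = contradiction (sym eq) (rest≢delayed v e i)
      β′-injective {inj₂ (e , i)} {inj₂ (f , j)} eq = cong inj₂ (delayed-injective e f i j eq)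

      src′ tgt′ : E′ → V′
      src′ (e , inj₁ x) = inj₂ (e , src x)
      src′ (e , inj₂ i) = inj₁ (point e i)
      tgt′ (e , inj₁ x) = inj₂ (e , tgt x)
      tgt′ (e , inj₂ i) = inj₂ (e , i)

      Incident′ : V′ → E′ → Set
      Incident′ v e = v ≡ src′ e ⊎ v ≡ tgt′ e

      -- The path of the particle runs through `point e i` in direction `d i`, and by `apart` no
      -- other word lies on it.
      meet-rest : ∀ w e i → (pos w ⊖ delayed s e i ∧ 0² ⊖ d i) ≡ 0ℤ → w ≡ point e i
      meet-rest w e i eq with Vec.≡-dec Fin._≟_ w (point e i)
      ... | yes w≡ = w≡
      ... | no ne = contradiction
        (ℤ.neg-injective (trans (sym (∧-motion-rest (pos w) (pos (point e i)) (d i) (κ e ℤ.* + s))) eq))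
        (apart w (point e i) i ne)

      d-difference : ∀ i j → d i ⊖ d j ≡ δ i ⊖ δ j
      d-difference i j = ⊕-⊖-cancel (δ i) (δ j) boost

      -- Inside one copy the common delay and the boost cancel, and what remains is a homothetic
      -- image of the original particles.
      within-copy : ∀ e i j → (delayed s e i ⊖ delayed s e j ∧ d i ⊖ d j) ≡
                              scale β μ (H.line e) ℤ.* (β i ⊖ β j ∧ δ i ⊖ δ j)
      within-copy e i j = begin
        (delayed s e i ⊖ delayed s e j ∧ d i ⊖ d j)
          ≡⟨ ∧-motions (pos (point e i)) (pos (point e j)) (d i) (d j) (κ e) (κ e) (+ s) ⟩
        (pos (point e i) ⊖ pos (point e j) ∧ d i ⊖ d j) ℤ.+ ((κ e ℤ.- κ e) ℤ.* (d i ∧ d j)) ℤ.* + s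
          ≡⟨ ring (pos (point e i) ⊖ pos (point e j) ∧ d i ⊖ d j) (κ e) (d i ∧ d j) (+ s) ⟩
        (pos (point e i) ⊖ pos (point e j) ∧ d i ⊖ d j)
          ≡⟨ cong₂ _∧_ (position-fill β μ (H.line e) i j) (d-difference i j) ⟩
        (scale β μ (H.line e) • (β i ⊖ β j) ∧ δ i ⊖ δ j)
          ≡⟨ •-∧ (scale β μ (H.line e)) (β i ⊖ β j) (δ i ⊖ δ j) ⟩
        scale β μ (H.line e) ℤ.* (β i ⊖ β j ∧ δ i ⊖ δ j) ∎
        where
        open ≡-Reasoning
        ring : ∀ a x b s → a ℤ.+ ((x ℤ.- x) ℤ.* b) ℤ.* s ≡ a
        ring = ℤ.solve-∀

      -- With scale 0 the distinct words `point e i` and `point e j` would share their position,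
      -- against `apart`.
      scale≢0 : ∀ e i j → i ≢ j → scale β μ (H.line e) ≢ 0ℤ
      scale≢0 e i j i≢j eq = apart (point e i) (point e j) i (i≢j ∘ fill-injective (H.hasVariable e))
        (trans (cong (λ z → z ∧ d i) (position-fill β μ (H.line e) i j))
          (trans (•-∧ (scale β μ (H.line e)) (β i ⊖ β j) (d i)) (cong (λ z → z ℤ.* (β i ⊖ β j ∧ d i)) eq)))

      meet⇒edge′ : ∀ {u v} → Meet (δ′ u) (β′ u) (δ′ v) (β′ v) → ∃[ e ] (Incident′ u e × Incident′ v e)
      meet⇒edge′ {inj₁ v} {inj₁ w} (ne , _) = contradiction refl ne
      meet⇒edge′ {inj₁ w} {inj₂ (e , i)} (_ , eq) = (e , inj₂ i) , inj₁ (cong inj₁ (meet-rest w e i eq)) , inj₂ refl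
      meet⇒edge′ {inj₂ (e , i)} {inj₁ w} m =
        (e , inj₂ i) , inj₂ refl , inj₁ (cong inj₁ (meet-rest w e i (proj₂ (Meet-sym {d i} {delayed s e i} m))))
      meet⇒edge′ {inj₂ (e , i)} {inj₂ (f , j)} (ne , eq) with e Fin.≟ f
      ... | no e≢f = contradiction eq (proj₁ good e f i j (e≢f , ne ∘ cong (_⊕ boost)))
      ... | yes refl with meet⇒edge {i} {j} (ne ∘ cong (_⊕ boost) , zero-wedge)
        where
        zero-wedge : (β i ⊖ β j ∧ δ i ⊖ δ j) ≡ 0ℤ
        zero-wedge with ℤ.i*j≡0⇒i≡0∨j≡0 (scale β μ (H.line e)) (trans (sym (within-copy e i j)) eq)
        ... | inj₁ scale≡0 = contradiction scale≡0 (scale≢0 e i j (ne ∘ cong d))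
        ... | inj₂ ∧≡0     = ∧≡0
      ...   | x , i∈ , j∈ = (e , inj₁ x) , lift i∈ , lift j∈
        where
        lift : ∀ {i} → Incident i x → Incident′ (inj₂ (e , i)) (e , inj₁ x)
        lift (inj₁ refl) = inj₁ refl
        lift (inj₂ refl) = inj₂ refl

      edge⇒meet′ : ∀ e → Meet (δ′ (src′ e)) (β′ (src′ e)) (δ′ (tgt′ e)) (β′ (tgt′ e))
      edge⇒meet′ (e , inj₁ x) = let ne , eq = edge⇒meet x in
        ne ∘ ⊕-cancelʳ (δ (src x)) (δ (tgt x)) boost ,
        trans (within-copy e (src x) (tgt x)) (trans (cong (scale β μ (H.line e) ℤ.*_) eq) (ℤ.*-zeroʳ (scale β μ (H.line e))))
      edge⇒meet′ (e , inj₂ i) = (λ eq → d₂≢0 i (cong ycoord (sym eq))) ,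
        trans (∧-motion-rest (pos (point e i)) (pos (point e i)) (d i) (κ e ℤ.* + s)) (cong ℤ.-_ (∧-self (pos (point e i)) (d i)))

      -- The pendant vertices are the resting words, along which the copies are glued; an edge has
      -- at most one end at rest.
      amalgam : Amalgam (Pendant Incident) (OnLine H.line) Incident′
      amalgam = record
        { _≟ᵛ_ = Vec.≡-dec Fin._≟_
        ; _≟ᵉ_ = Fin._≟_
        ; ι = ι
        ; copy = proj₁
        ; under = proj₂
        ; Shared = Shared
        ; ρ = ρ
        ; ι-inj = ι-inj
        ; edge-inj = λ { refl refl → refl }
        ; incident = incident
        ; overlap⇒shared = overlap⇒shared
        ; ρ-incident = λ { {e} {inj₁ i} _ → i , refl }
        ; ρ-inj = λ { {p = inj₁ _} {inj₁ _} _ _ eq → cong inj₁ eq }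
        ; shared-unique = λ { {inj₁ _} {inj₁ _} {inj₂ _} refl refl _ _ → refl }
        }
        where
        ι : Fin H.count → Fin n ⊎ Fin n → V′
        ι e (inj₁ i) = inj₁ (point e i)
        ι e (inj₂ i) = inj₂ (e , i)
        Shared : Fin n ⊎ Fin n → Set
        Shared (inj₁ _) = ⊤
        Shared (inj₂ _) = ⊥
        ρ : V′ → Word
        ρ (inj₁ w)       = w
        ρ (inj₂ (e , i)) = point e i
        ι-inj : ∀ {e p q} → ι e p ≡ ι e q → p ≡ q
        ι-inj {e} {inj₁ _} {inj₁ _} eq   = cong inj₁ (fill-injective (H.hasVariable e) (Sum.inj₁-injective eq))
        ι-inj {e} {inj₂ _} {inj₂ _} refl = refl
        incident : ∀ {q ℓ} → Incident′ q ℓ → ∃[ p ] (Pendant Incident p (proj₂ ℓ) × ι (proj₁ ℓ) p ≡ q)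
        incident {ℓ = e , inj₁ x} (inj₁ refl) = inj₂ (src x) , inj₁ refl , refl
        incident {ℓ = e , inj₁ x} (inj₂ refl) = inj₂ (tgt x) , inj₂ refl , refl
        incident {ℓ = e , inj₂ i} (inj₁ refl) = inj₁ i , refl , refl
        incident {ℓ = e , inj₂ i} (inj₂ refl) = inj₂ i , refl , refl
        overlap⇒shared : ∀ {e f p q} → e ≢ f → ι e p ≡ ι f q → Shared p
        overlap⇒shared {p = inj₁ _}          e≢f eq   = tt
        overlap⇒shared {p = inj₂ _} {inj₂ _} e≢f refl = contradiction refl e≢f

      -- Take a line `e` whose words have one colour. If no particle of its copy has this colour,
      -- the copy uses the `k` others only; punching the colour out gives a `k`-colouring of the
      -- original particles, which fails on some edge.
      uncolourable′ : ∀ (f : V′ → Fin (suc k)) → ∃[ e ] f (src′ e) ≡ f (tgt′ e)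
      uncolourable′ f with H.monochromatic (f ∘ inj₁)
      ... | e , mono with Fin.any? (λ i → f (inj₁ (point e i)) Fin.≟ f (inj₂ (e , i)))
      ...   | yes (i , eq) = (e , inj₂ i) , eq
      ...   | no none = let x , eq = uncolourable (λ i → Fin.punchOut (avoids i))
                        in (e , inj₁ x) , punchOut-injective′ (avoids (src x)) (avoids (tgt x)) (mono _ _) eq
        where
        avoids : ∀ i → f (inj₁ (point e i)) ≢ f (inj₂ (e , i))
        avoids i eq = none (i , eq)

      arrangement : Arrangement V′ g (suc k)
      arrangement = record
        { Edge         = E′
        ; src          = src′
        ; tgt          = tgt′
        ; δ            = δ′
        ; β            = β′
        ; β-injective  = β′-injective
        ; meet⇒edge    = meet⇒edge′
        ; edge⇒meet    = edge⇒meet′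
        ; girth        = amalgam-girth amalgam (pendant-girth Incident girth) H.girth g≤2h
        ; uncolourable = uncolourable′
        }

  zykov : g ≤ 2 * h → Arrangement (Vec (Fin n) H.length ⊎ (Fin H.count × Fin n)) g (suc k)
  zykov g≤2h = arrangement g≤2h (proj₁ generic) (proj₂ generic (proj₁ generic) ℕ.≤-refl)
    where
    B = findBoost δ β β-injective
    weights = findWeights β (Boost.d B) (Boost.separated B) H.length
    open Delayed B (proj₁ weights) (proj₂ weights) (λ e → + suc (toℕ e)) (λ _ ())
                 (Fin.toℕ-injective ∘ ℕ.suc-injective ∘ ℤ.+-injective)

arrangement : ∀ j k → Σ[ n ∈ ℕ ] Arrangement (Fin n) (2 ^ j) k
-- A single particle has no colouring with 0 colours.
arrangement j zero = 1 , record
  { Edge         = ⊥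
  ; src          = λ ()
  ; tgt          = λ ()
  ; δ            = λ _ → 0²
  ; β            = λ _ → 0²
  ; β-injective  = λ { {zero} {zero} _ → refl }
  ; meet⇒edge    = λ (ne , _) → contradiction refl ne
  ; edge⇒meet    = λ ()
  ; girth        = λ { (start _ _ p≢p) → contradiction refl p≢p
                     ; (extend {q = zero} {r = zero} _ _ _ _ q≢r) → contradiction refl q≢r }
  ; uncolourable = λ f → contradiction (f zero) Fin.¬Fin0
  }
arrangement j (suc k) with arrangement j k
... | n , A = n ^ H.length + H.count * n , reindex to from from-to to-from (zykov A H (ℕ.m≤n*m (2 ^ j) 2))
  where
  H = sparse-hales-jewett j n (suc k)
  module H = SparseHalesJewett H
  V = Vec (Fin n) H.length ⊎ (Fin H.count × Fin n)
  to : V → Fin (n ^ H.length + H.count * n)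
  to (inj₁ w)       = encode w Fin.↑ˡ (H.count * n)
  to (inj₂ (e , i)) = (n ^ H.length) Fin.↑ʳ Fin.combine e i
  unsplit : Fin (n ^ H.length) ⊎ Fin (H.count * n) → V
  unsplit (inj₁ i) = inj₁ (decode H.length i)
  unsplit (inj₂ i) = inj₂ (Fin.remQuot n i)
  from : Fin (n ^ H.length + H.count * n) → V
  from i = unsplit (Fin.splitAt (n ^ H.length) i)
  from-to : ∀ v → from (to v) ≡ v
  from-to (inj₁ w)       = trans (cong unsplit (Fin.splitAt-↑ˡ (n ^ H.length) (encode w) (H.count * n))) (cong inj₁ (decode-encode w))
  from-to (inj₂ (e , i)) = trans (cong unsplit (Fin.splitAt-↑ʳ (n ^ H.length) (H.count * n) (Fin.combine e i))) (cong inj₂ (Fin.remQuot-combine e i))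
  to-unsplit : ∀ x → to (unsplit x) ≡ Fin.join (n ^ H.length) (H.count * n) x
  to-unsplit (inj₁ i) = cong (Fin._↑ˡ (H.count * n)) (encode-decode H.length i)
  to-unsplit (inj₂ i) = cong ((n ^ H.length) Fin.↑ʳ_) (Fin.combine-remQuot {H.count} n i)
  to-from : ∀ i → to (from i) ≡ i
  to-from i = trans (to-unsplit (Fin.splitAt (n ^ H.length) i)) (Fin.join-splitAt (n ^ H.length) (H.count * n) i)

-- Lines in ℝ³

-- Passes through the unnormalised rationals, where the homomorphism laws reduce to integer
-- identities.
φ : ℤ → ℚ
φ i = ℚ.fromℚᵘ (mkℚᵘ i 0)

φ-injective : ∀ {i j} → φ i ≡ φ j → i ≡ j
φ-injective {i} {j} eq with ℚ.fromℚᵘ-injective {mkℚᵘ i 0} {mkℚᵘ j 0} eq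
... | *≡* eq′ = trans (sym (ℤ.*-identityʳ i)) (trans eq′ (ℤ.*-identityʳ j))

φ-+ : ∀ i j → φ (i ℤ.+ j) ≡ φ i ℚ.+ φ j
φ-+ i j = ℚ.toℚᵘ-injective (begin
  ℚ.toℚᵘ (φ (i ℤ.+ j))                ≈⟨ ℚ.toℚᵘ-fromℚᵘ (mkℚᵘ (i ℤ.+ j) 0) ⟩
  mkℚᵘ (i ℤ.+ j) 0                    ≈⟨ *≡* (ring i j) ⟩
  mkℚᵘ i 0 ℚᵘ.+ mkℚᵘ j 0              ≈⟨ ℚᵘ.+-cong (ℚ.toℚᵘ-fromℚᵘ (mkℚᵘ i 0)) (ℚ.toℚᵘ-fromℚᵘ (mkℚᵘ j 0)) ⟨
  ℚ.toℚᵘ (φ i) ℚᵘ.+ ℚ.toℚᵘ (φ j)      ≈⟨ ℚ.toℚᵘ-homo-+ (φ i) (φ j) ⟨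
  ℚ.toℚᵘ (φ i ℚ.+ φ j)                ∎)
  where
  open import Relation.Binary.Reasoning.Setoid ℚᵘ.≃-setoid
  ring : ∀ i j → (i ℤ.+ j) ℤ.* 1ℤ ≡ (i ℤ.* 1ℤ ℤ.+ j ℤ.* 1ℤ) ℤ.* 1ℤ
  ring = ℤ.solve-∀

φ-* : ∀ i j → φ (i ℤ.* j) ≡ φ i ℚ.* φ j
φ-* i j = ℚ.toℚᵘ-injective (begin
  ℚ.toℚᵘ (φ (i ℤ.* j))                ≈⟨ ℚ.toℚᵘ-fromℚᵘ (mkℚᵘ (i ℤ.* j) 0) ⟩
  mkℚᵘ i 0 ℚᵘ.* mkℚᵘ j 0              ≈⟨ ℚᵘ.*-cong (ℚ.toℚᵘ-fromℚᵘ (mkℚᵘ i 0)) (ℚ.toℚᵘ-fromℚᵘ (mkℚᵘ j 0)) ⟨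
  ℚ.toℚᵘ (φ i) ℚᵘ.* ℚ.toℚᵘ (φ j)      ≈⟨ ℚ.toℚᵘ-homo-* (φ i) (φ j) ⟨
  ℚ.toℚᵘ (φ i ℚ.* φ j)                ∎)
  where open import Relation.Binary.Reasoning.Setoid ℚᵘ.≃-setoid

φ-neg : ∀ i → φ (ℤ.- i) ≡ ℚ.- φ i
φ-neg i = ℚ.toℚᵘ-injective (begin
  ℚ.toℚᵘ (φ (ℤ.- i))                  ≈⟨ ℚ.toℚᵘ-fromℚᵘ (mkℚᵘ (ℤ.- i) 0) ⟩
  ℚᵘ.- mkℚᵘ i 0                       ≈⟨ ℚᵘ.-‿cong (ℚ.toℚᵘ-fromℚᵘ (mkℚᵘ i 0)) ⟨
  ℚᵘ.- ℚ.toℚᵘ (φ i)                   ≈⟨ ℚ.toℚᵘ-homo‿- (φ i) ⟨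
  ℚ.toℚᵘ (ℚ.- φ i)                    ∎)
  where open import Relation.Binary.Reasoning.Setoid ℚᵘ.≃-setoid

φ-- : ∀ i j → φ (i ℤ.- j) ≡ φ i ℚ.- φ j
φ-- i j = trans (φ-+ i (ℤ.- j)) (cong (λ z → φ i ℚ.+ z) (φ-neg j))

-- `x ≈ y` unfolds to `Null` of the difference of the sequences, so equations between reals can be
-- combined as null sequences of rationals.
Null : (ℕ → ℚ) → Set
Null z = ∀ ε → 0ℚ ℚ.< ε → ∃[ N ] (∀ n → N ≤ n → ℚ.∣ z n ∣ ℚ.< ε)

null-cong : ∀ {y z} → (∀ n → y n ≡ z n) → Null y → Null z
null-cong eq ny ε 0<ε = let N , hy = ny ε 0<ε in
  N , λ n le → subst (λ x → ℚ.∣ x ∣ ℚ.< ε) (eq n) (hy n le)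

null-+ : ∀ {y z} → Null y → Null z → Null (λ n → y n ℚ.+ z n)
null-+ {y} {z} ny nz ε 0<ε =
  let δ , 0<δ , 2δ≡ε = divide (1ℚ ℚ.+ 1ℚ) ε (ℚ.positive⁻¹ (1ℚ ℚ.+ 1ℚ)) 0<ε
      M , hy = ny δ 0<δ
      N , hz = nz δ 0<δ
  in M ⊔ N , λ n le → begin-strict
    ℚ.∣ y n ℚ.+ z n ∣          ≤⟨ ℚ.∣p+q∣≤∣p∣+∣q∣ (y n) (z n) ⟩
    ℚ.∣ y n ∣ ℚ.+ ℚ.∣ z n ∣    <⟨ ℚ.+-mono-< (hy n (ℕ.m⊔n≤o⇒m≤o M N le)) (hz n (ℕ.m⊔n≤o⇒n≤o M N le)) ⟩
    δ ℚ.+ δ                    ≡⟨ double δ ⟩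
    (1ℚ ℚ.+ 1ℚ) ℚ.* δ          ≡⟨ 2δ≡ε ⟩
    ε                          ∎
  where
  open ℚ.≤-Reasoning
  double : ∀ a → a ℚ.+ a ≡ (1ℚ ℚ.+ 1ℚ) ℚ.* a
  double = solve 1 (λ a → a :+ a := (con 1ℚ :+ con 1ℚ) :* a) refl
    where open +-*-Solver

null-* : ∀ c {z} → Null z → Null (λ n → c ℚ.* z n)
null-* c {z} nz ε 0<ε =
  let B = 1ℚ ℚ.+ ℚ.∣ c ∣
      0<B = ℚ.+-mono-<-≤ (ℚ.positive⁻¹ 1ℚ) (ℚ.0≤∣p∣ c)
      δ , 0<δ , Bδ≡ε = divide B ε 0<B 0<ε
      N , hz = nz δ 0<δ
  in N , λ n le → begin-strict
    ℚ.∣ c ℚ.* z n ∣            ≡⟨ ℚ.∣p*q∣≡∣p∣*∣q∣ c (z n) ⟩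
    ℚ.∣ c ∣ ℚ.* ℚ.∣ z n ∣      ≤⟨ ℚ.*-monoʳ-≤-nonNeg ℚ.∣ z n ∣ {{ℚ.∣-∣-nonNeg (z n)}} (c≤B c) ⟩
    B ℚ.* ℚ.∣ z n ∣            <⟨ ℚ.*-monoʳ-<-pos B {{ℚ.positive 0<B}} (hz n le) ⟩
    B ℚ.* δ                    ≡⟨ Bδ≡ε ⟩
    ε                          ∎
  where
  open ℚ.≤-Reasoning
  c≤B : ∀ c → ℚ.∣ c ∣ ℚ.≤ 1ℚ ℚ.+ ℚ.∣ c ∣
  c≤B c = subst (ℚ._≤ 1ℚ ℚ.+ ℚ.∣ c ∣) (ℚ.+-identityˡ ℚ.∣ c ∣) (ℚ.+-monoˡ-≤ ℚ.∣ c ∣ (ℚ.<⇒≤ (ℚ.positive⁻¹ 1ℚ)))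

-- Leads from real equations back to exact ones: for c ≢ 0 the choice ε = ∣c∣ would give ∣c∣ < ∣c∣.
null-constant : ∀ {c} → Null (λ _ → c) → c ≡ 0ℚ
null-constant {c} nc with c ℚ.≟ 0ℚ
... | yes c≡0 = c≡0
... | no  c≢0 = let N , h = nc ℚ.∣ c ∣ 0<∣c∣ in contradiction (h N ℕ.≤-refl) (ℚ.<-irrefl refl)
  where
  0<∣c∣ : 0ℚ ℚ.< ℚ.∣ c ∣
  0<∣c∣ = ℚ.≰⇒> λ le → c≢0 (ℚ.∣p∣≡0⇒p≡0 c (ℚ.≤-antisym le (ℚ.0≤∣p∣ c)))

≡⇒≈ : ∀ {x y} → (∀ n → seq x n ≡ seq y n) → x ≈ y
≡⇒≈ {x} {y} eq ε 0<ε = 0 , λ n _ → subst (ℚ._< ε) (sym (cong ℚ.∣_∣ (trans (cong (ℚ._- seq y n) (eq n)) (ℚ.+-inverseʳ (seq y n))))) 0<ε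

-- The trajectory of a particle, with time as the first coordinate.
origin direction : ℤ² → Point 3
origin    ⟨ x , y ⟩ zero             = 0ℝ
origin    ⟨ x , y ⟩ (suc zero)       = fromℚ (φ x)
origin    ⟨ x , y ⟩ (suc (suc zero)) = fromℚ (φ y)
direction ⟨ x , y ⟩ zero             = fromℚ 1ℚ
direction ⟨ x , y ⟩ (suc zero)       = fromℚ (φ x)
direction ⟨ x , y ⟩ (suc (suc zero)) = fromℚ (φ y)

worldLine : (δ β : ℤ²) → Pred (Point 3) _
worldLine δ β = lineThrough (origin β) (direction δ)

direction≉0 : ∀ δ → ¬ (direction δ ≈ₚ λ _ → 0ℝ)
direction≉0 ⟨ _ , _ ⟩ eq = contradiction (null-constant {1ℚ ℚ.- 0ℚ} (eq zero)) λ ()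

at : (δ β : ℤ²) → ℚ → Point 3
at δ β τ i = origin β i +ʳ fromℚ τ *ʳ direction δ i

at∈worldLine : ∀ δ β τ → worldLine δ β (at δ β τ)
at∈worldLine δ β τ = fromℚ τ , λ i → ≡⇒≈ {at δ β τ i} {at δ β τ i} λ _ → refl

-- Cancels the times t, t′ at which two particles pass through x: the separation of
-- their positions at time t tends to 0.
null-separation : ∀ {x₀ x₁ t t′ : ℕ → ℚ} b d b′ d′ →
  Null (λ n → x₀ n ℚ.- (0ℚ ℚ.+ t n ℚ.* 1ℚ)) → Null (λ n → x₀ n ℚ.- (0ℚ ℚ.+ t′ n ℚ.* 1ℚ)) →
  Null (λ n → x₁ n ℚ.- (φ b ℚ.+ t n ℚ.* φ d)) → Null (λ n → x₁ n ℚ.- (φ b′ ℚ.+ t′ n ℚ.* φ d′)) →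
  Null (λ n → φ (b ℤ.- b′) ℚ.+ t n ℚ.* φ (d ℤ.- d′))
null-separation {x₀} {x₁} {t} {t′} b d b′ d′ n₀ n₀′ n₁ n₁′ = null-cong
  (λ n → trans (ring (x₀ n) (x₁ n) (t n) (t′ n) (φ b) (φ d) (φ b′) (φ d′))
    (sym (cong₂ (λ u v → u ℚ.+ t n ℚ.* v) (φ-- b b′) (φ-- d d′))))
  (null-+ (null-+ n₁′ (null-* (ℚ.- 1ℚ) n₁)) (null-* (ℚ.- φ d′) (null-+ n₀′ (null-* (ℚ.- 1ℚ) n₀))))
  where
  ring : ∀ x₀ x₁ t t′ b d b′ d′ →
    ((x₁ ℚ.- (b′ ℚ.+ t′ ℚ.* d′)) ℚ.+ (ℚ.- 1ℚ) ℚ.* (x₁ ℚ.- (b ℚ.+ t ℚ.* d))) ℚ.+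
    (ℚ.- d′) ℚ.* ((x₀ ℚ.- (0ℚ ℚ.+ t′ ℚ.* 1ℚ)) ℚ.+ (ℚ.- 1ℚ) ℚ.* (x₀ ℚ.- (0ℚ ℚ.+ t ℚ.* 1ℚ)))
    ≡ (b ℚ.- b′) ℚ.+ t ℚ.* (d ℚ.- d′)
  ring = solve 8 (λ x₀ x₁ t t′ b d b′ d′ →
    ((x₁ :- (b′ :+ t′ :* d′)) :+ (:- con 1ℚ) :* (x₁ :- (b :+ t :* d))) :+
    (:- d′) :* ((x₀ :- (con 0ℚ :+ t′ :* con 1ℚ)) :+ (:- con 1ℚ) :* (x₀ :- (con 0ℚ :+ t :* con 1ℚ)))
    := (b :- b′) :+ t :* (d :- d′)) refl
    where open +-*-Solver

commonPoint : ∀ {δ β δ′ β′ x} ((t , _) : worldLine δ β x) → worldLine δ′ β′ x →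
  Null (λ n → φ (xcoord (β ⊖ β′)) ℚ.+ seq t n ℚ.* φ (xcoord (δ ⊖ δ′))) ×
  Null (λ n → φ (ycoord (β ⊖ β′)) ℚ.+ seq t n ℚ.* φ (ycoord (δ ⊖ δ′)))
commonPoint {⟨ d , e ⟩} {⟨ b , c ⟩} {⟨ d′ , e′ ⟩} {⟨ b′ , c′ ⟩} {x} (t , on) (t′ , on′) =
  null-separation {seq (x zero)} {seq (x (suc zero))} {seq t} {seq t′} b d b′ d′
    (on zero) (on′ zero) (on (suc zero)) (on′ (suc zero)) ,
  null-separation {seq (x zero)} {seq (x (suc (suc zero)))} {seq t} {seq t′} c e c′ e′
    (on zero) (on′ zero) (on (suc (suc zero))) (on′ (suc (suc zero)))

components≡0 : ∀ u → φ (xcoord u) ≡ 0ℚ → φ (ycoord u) ≡ 0ℚ → u ≡ 0²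
components≡0 ⟨ a , b ⟩ p q = cong₂ ⟨_,_⟩ (φ-injective p) (φ-injective q)

still : ∀ b t d → d ≡ 0ℚ → b ℚ.+ t ℚ.* d ≡ b
still b t _ refl = trans (cong (λ z → b ℚ.+ z) (ℚ.*-zeroʳ t)) (ℚ.+-identityʳ b)

-- At equal velocities the separation is constant; as a null sequence it is 0, and the initial
-- positions agree.
intersect⇒velocities≢ : ∀ {δ β δ′ β′} → β ≢ β′ → worldLine δ β ≬ worldLine δ′ β′ → δ ≢ δ′
intersect⇒velocities≢ {δ} {β} {_} {β′} β≢β′ (x , x∈@(t , _) , x∈′) refl =
  β≢β′ (⊖≡0⇒≡ β β′ (components≡0 (β ⊖ β′)
    (null-constant (null-cong (λ n → still _ (seq t n) _ (cong (φ ∘ xcoord) (⊖-self δ))) (proj₁ nulls)))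
    (null-constant (null-cong (λ n → still _ (seq t n) _ (cong (φ ∘ ycoord) (⊖-self δ))) (proj₂ nulls)))))
  where nulls = commonPoint {δ} {β} {δ} {β′} {x} x∈ x∈′

-- The combination with coefficients `φ d` and `ℚ.- φ c` eliminates `t` and leaves the determinant.
null⇒∧≡0 : ∀ u v {t : ℕ → ℚ} → Null (λ n → φ (xcoord u) ℚ.+ t n ℚ.* φ (xcoord v)) →
           Null (λ n → φ (ycoord u) ℚ.+ t n ℚ.* φ (ycoord v)) → (u ∧ v) ≡ 0ℤ
null⇒∧≡0 ⟨ a , b ⟩ ⟨ c , d ⟩ {t} n₁ n₂ = φ-injective (null-constant (null-cong
  (λ n → trans (ring (φ a) (φ b) (φ c) (φ d) (t n))
    (sym (trans (φ-- (a ℤ.* d) (b ℤ.* c)) (cong₂ ℚ._-_ (φ-* a d) (φ-* b c)))))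
  (null-+ (null-* (φ d) n₁) (null-* (ℚ.- φ c) n₂))))
  where
  ring : ∀ a b c d t → d ℚ.* (a ℚ.+ t ℚ.* c) ℚ.+ (ℚ.- c) ℚ.* (b ℚ.+ t ℚ.* d) ≡ a ℚ.* d ℚ.- b ℚ.* c
  ring = solve 5 (λ a b c d t → d :* (a :+ t :* c) :+ (:- c) :* (b :+ t :* d) := a :* d :- b :* c) refl
    where open +-*-Solver

intersect⇒meet : ∀ {δ β δ′ β′} → β ≢ β′ → worldLine δ β ≬ worldLine δ′ β′ → Meet δ β δ′ β′
intersect⇒meet {δ} {β} {δ′} {β′} β≢β′ common@(x , x∈ , x∈′) =
  intersect⇒velocities≢ {δ} {β} {δ′} {β′} β≢β′ common ,
  null⇒∧≡0 (β ⊖ β′) (δ ⊖ δ′) {seq (proj₁ x∈)} (proj₁ nulls) (proj₂ nulls)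
  where nulls = commonPoint {δ} {β} {δ′} {β′} {x} x∈ x∈′

-- The first coordinate is the time, so both particles are at this point at time 0.
starts-equal : ∀ {δ β δ′ β′} → worldLine δ′ β′ (at δ β 0ℚ) → β ≡ β′
starts-equal {δ} {β} {δ′} {β′} x∈′ = ⊖≡0⇒≡ β β′ (components≡0 (β ⊖ β′)
  (null-constant (null-cong (λ _ → stop _ (φ (xcoord (δ ⊖ δ′)))) (proj₁ nulls)))
  (null-constant (null-cong (λ _ → stop _ (φ (ycoord (δ ⊖ δ′)))) (proj₂ nulls))))
  where
  nulls = commonPoint {δ} {β} {δ′} {β′} {at δ β 0ℚ} (at∈worldLine δ β 0ℚ) x∈′
  stop : ∀ b d → b ℚ.+ 0ℚ ℚ.* d ≡ b
  stop b d = trans (cong (λ z → b ℚ.+ z) (ℚ.*-zeroˡ d)) (ℚ.+-identityʳ b)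

-- τ = -b₁ / d₁ solves the first equation, and the vanishing determinant carries it over to the
-- second.
collisionTime : ∀ b₁ b₂ d₁ d₂ → d₁ ≢ 0ℚ → b₁ ℚ.* d₂ ℚ.- b₂ ℚ.* d₁ ≡ 0ℚ →
                ∃[ τ ] (b₁ ℚ.+ τ ℚ.* d₁ ≡ 0ℚ × b₂ ℚ.+ τ ℚ.* d₂ ≡ 0ℚ)
collisionTime b₁ b₂ d₁ d₂ d₁≢0 det≡0 = ℚ.- b₁ ℚ.* inv ,
  (trans (ring₁ b₁ d₁ inv) (trans (cong (λ z → b₁ ℚ.- b₁ ℚ.* z) inverse) (cancel₁ b₁))) ,
  (trans (ring₂ b₁ b₂ d₁ d₂ inv)
    (trans (cong₂ (λ z w → b₂ ℚ.- z ℚ.* b₂ ℚ.- inv ℚ.* w) inverse det≡0) (cancel₂ b₂ inv)))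
  where
  open +-*-Solver
  inv = ℚ.1/_ d₁ {{ℚ.≢-nonZero d₁≢0}}
  inverse : inv ℚ.* d₁ ≡ 1ℚ
  inverse = ℚ.*-inverseˡ d₁ {{ℚ.≢-nonZero d₁≢0}}
  ring₁ : ∀ b d i → b ℚ.+ ℚ.- b ℚ.* i ℚ.* d ≡ b ℚ.- b ℚ.* (i ℚ.* d)
  ring₁ = solve 3 (λ b d i → b :+ :- b :* i :* d := b :- b :* (i :* d)) refl
  cancel₁ : ∀ b → b ℚ.- b ℚ.* 1ℚ ≡ 0ℚ
  cancel₁ = solve 1 (λ b → b :- b :* con 1ℚ := con 0ℚ) refl
  ring₂ : ∀ b₁ b₂ d₁ d₂ i → b₂ ℚ.+ ℚ.- b₁ ℚ.* i ℚ.* d₂ ≡ b₂ ℚ.- i ℚ.* d₁ ℚ.* b₂ ℚ.- i ℚ.* (b₁ ℚ.* d₂ ℚ.- b₂ ℚ.* d₁)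
  ring₂ = solve 5 (λ b₁ b₂ d₁ d₂ i → b₂ :+ :- b₁ :* i :* d₂ := b₂ :- i :* d₁ :* b₂ :- i :* (b₁ :* d₂ :- b₂ :* d₁)) refl
  cancel₂ : ∀ b i → b ℚ.- 1ℚ ℚ.* b ℚ.- i ℚ.* 0ℚ ≡ 0ℚ
  cancel₂ = solve 2 (λ b i → b :- con 1ℚ :* b :- i :* con 0ℚ := con 0ℚ) refl

meetTime : ∀ u v → v ≢ 0² → (u ∧ v) ≡ 0ℤ → ∃[ τ ] (φ (xcoord u) ℚ.+ τ ℚ.* φ (xcoord v) ≡ 0ℚ ×
                                                  φ (ycoord u) ℚ.+ τ ℚ.* φ (ycoord v) ≡ 0ℚ)
meetTime ⟨ a , b ⟩ ⟨ c , d ⟩ v≢0 eq with c ℤ.≟ 0ℤ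
... | no c≢0 = collisionTime (φ a) (φ b) (φ c) (φ d) (c≢0 ∘ φ-injective) det≡0
  where
  det≡0 : φ a ℚ.* φ d ℚ.- φ b ℚ.* φ c ≡ 0ℚ
  det≡0 = trans (sym (trans (φ-- (a ℤ.* d) (b ℤ.* c)) (cong₂ ℚ._-_ (φ-* a d) (φ-* b c)))) (cong φ eq)
-- The first component of the relative velocity vanishes, so the second, which is non-zero,
-- determines the time.
... | yes refl = let τ , p , q = collisionTime (φ b) (φ a) (φ d) 0ℚ (λ d≡0 → v≢0 (cong ⟨ 0ℤ ,_⟩ (φ-injective d≡0))) det≡0
                 in τ , q , p
  where
  open +-*-Solver
  swap : ∀ a b d → b ℚ.* 0ℚ ℚ.- a ℚ.* d ≡ ℚ.- (a ℚ.* d ℚ.- b ℚ.* 0ℚ)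
  swap = solve 3 (λ a b d → b :* con 0ℚ :- a :* d := :- (a :* d :- b :* con 0ℚ)) refl
  det≡0 : φ b ℚ.* 0ℚ ℚ.- φ a ℚ.* φ d ≡ 0ℚ
  det≡0 = trans (swap (φ a) (φ b) (φ d)) (cong ℚ.-_
    (trans (sym (trans (φ-- (a ℤ.* d) (b ℤ.* 0ℤ)) (cong₂ ℚ._-_ (φ-* a d) (φ-* b 0ℤ)))) (cong φ eq)))

meet⇒intersect : ∀ {δ β δ′ β′} → Meet δ β δ′ β′ → worldLine δ β ≬ worldLine δ′ β′
meet⇒intersect {δ@(⟨ d , e ⟩)} {β@(⟨ b , c ⟩)} {δ′@(⟨ d′ , e′ ⟩)} {β′@(⟨ b′ , c′ ⟩)} (ne , eq)
  with meetTime (β ⊖ β′) (δ ⊖ δ′) (ne ∘ ⊖≡0⇒≡ δ δ′) eq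
... | τ , p , q = at δ β τ , at∈worldLine δ β τ , fromℚ τ , on
  where
  coincide : ∀ b d b′ d′ → φ (b ℤ.- b′) ℚ.+ τ ℚ.* φ (d ℤ.- d′) ≡ 0ℚ → φ b ℚ.+ τ ℚ.* φ d ≡ φ b′ ℚ.+ τ ℚ.* φ d′
  coincide b d b′ d′ p = trans (ring (φ b) (φ d) (φ b′) (φ d′) τ)
    (trans (cong (λ z → φ b′ ℚ.+ τ ℚ.* φ d′ ℚ.+ z) (trans (sym (cong₂ (λ u v → u ℚ.+ τ ℚ.* v) (φ-- b b′) (φ-- d d′))) p)) (ℚ.+-identityʳ _))
    where
    ring : ∀ b d b′ d′ t → b ℚ.+ t ℚ.* d ≡ b′ ℚ.+ t ℚ.* d′ ℚ.+ ((b ℚ.- b′) ℚ.+ t ℚ.* (d ℚ.- d′))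
    ring = solve 5 (λ b d b′ d′ t → b :+ t :* d := b′ :+ t :* d′ :+ ((b :- b′) :+ t :* (d :- d′))) refl
      where open +-*-Solver
  on : at δ β τ ≈ₚ at δ′ β′ τ
  on zero             = ≡⇒≈ {at δ β τ zero} {at δ′ β′ τ zero} λ _ → refl
  on (suc zero)       = ≡⇒≈ {at δ β τ (suc zero)} {at δ′ β′ τ (suc zero)} λ _ → coincide b d b′ d′ p
  on (suc (suc zero)) = ≡⇒≈ {at δ β τ (suc (suc zero))} {at δ′ β′ τ (suc (suc zero))} λ _ → coincide c e c′ e′ q

-- Girth and chromatic number of the intersection graph

module _ {P : ℕ → Set} (P? : ∀ n → Dec (P n)) where

  -- Girth and chromatic number have to be exhibited as values; bounded search finds them because
  -- the predicates are decidable.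
  leastBelow : ∀ m → ∃[ n ] IsLeast P n ⊎ (∀ n → n < m → ¬ P n)
  leastBelow zero    = inj₂ λ n ()
  leastBelow (suc m) with leastBelow m | P? m
  ... | inj₁ least | _     = inj₁ least
  ... | inj₂ none  | yes p = inj₁ (m , p , λ n q → ℕ.≮⇒≥ λ n<m → none n n<m q)
  ... | inj₂ none  | no ¬p = inj₂ λ n n<1+m q → case n n<1+m q (ℕ.m<1+n⇒m<n∨m≡n n<1+m)
    where
    case : ∀ n → n < suc m → P n → n < m ⊎ n ≡ m → _
    case n _ q (inj₁ n<m) = none n n<m q
    case n _ q (inj₂ refl) = ¬p q

  least : ∀ {m} → P m → ∃[ n ] IsLeast P n
  least {m} p with leastBelow (suc m)
  ... | inj₁ l    = l
  ... | inj₂ none = contradiction p (none m ℕ.≤-refl)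

-- Only the functions decoded from numbers are searched; `P` has to respect pointwise equality to
-- reach all others.
anyFunction? : ∀ {m n} {P : (Fin m → Fin n) → Set} → (∀ f → Dec (P f)) →
               (∀ {f g} → (∀ i → f i ≡ g i) → P f → P g) → Dec (∃[ f ] P f)
anyFunction? P? resp = map′ (λ (i , p) → Fin.finToFun i , p)
  (λ (f , p) → Fin.funToFin f , resp (λ i → sym (Fin.finToFun-funToFin f i)) p)
  (Fin.any? (P? ∘ Fin.finToFun))

module _ {V E : Set} {I : V → E → Set} where

  toWalk : ∀ m (c : Fin (2 + m) → V) (e : Fin (suc m) → E) →
           (∀ i → I (c (inject₁ i)) (e i)) → (∀ i → I (c (suc i)) (e i)) → (∀ i → c (inject₁ i) ≢ c (suc i)) →
           (∀ i → e (inject₁ i) ≢ e (suc i)) → Walk I (c zero) (e (fromℕ m)) (c (fromℕ (suc m))) (suc m)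
  toWalk zero    c e in₁ in₂ c≢ e≢ = start (in₁ zero) (in₂ zero) (c≢ zero)
  toWalk (suc m) c e in₁ in₂ c≢ e≢ =
    extend (toWalk m (c ∘ inject₁) (e ∘ inject₁) (in₁ ∘ inject₁) (in₂ ∘ inject₁) (c≢ ∘ inject₁) (e≢ ∘ inject₁))
      (e≢ (fromℕ m)) (in₁ (fromℕ (suc m))) (in₂ (fromℕ (suc m))) (c≢ (fromℕ (suc m)))

fromℕ-or-inject₁ : ∀ {n} (i : Fin (suc n)) → i ≡ fromℕ n ⊎ ∃[ j ] i ≡ inject₁ j
fromℕ-or-inject₁ {zero}  zero    = inj₁ refl
fromℕ-or-inject₁ {suc n} zero    = inj₂ (zero , refl)
fromℕ-or-inject₁ {suc n} (suc i) with fromℕ-or-inject₁ i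
... | inj₁ eq       = inj₁ (cong suc eq)
... | inj₂ (j , eq) = inj₂ (suc j , cong suc eq)

module _ {V : Set} {m : ℕ} (1<m : 1 < m) (c : Fin (2 + m) → V)
         (inj : Injective _≡_ _≡_ (c ∘ inject₁)) (closed : c (fromℕ (suc m)) ≡ c zero) where

  -- If i + 2 is not the last index, injectivity would give i = i + 2. If it is, the last vertex is
  -- the first one, so i = 0 and the cycle would have length 2.
  cycle-no-return : ∀ (i : Fin m) → c (inject₁ (inject₁ i)) ≢ c (suc (suc i))
  cycle-no-return i eq with fromℕ-or-inject₁ (suc (suc i))
  ... | inj₂ (j , ss≡) = ℕ.m≢1+n+m (toℕ i) {1} (trans (sym (Fin.toℕ-inject₁ i)) (trans (cong toℕ i≡j)
          (sym (trans (cong toℕ ss≡) (Fin.toℕ-inject₁ j)))))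
    where
    i≡j : inject₁ i ≡ j
    i≡j = inj (trans eq (cong c ss≡))
  ... | inj₁ ss≡ = ℕ.<⇒≢ 1<m (trans (cong suc (sym i≡0)) (ℕ.suc-injective (trans (cong toℕ ss≡) (Fin.toℕ-fromℕ (suc m)))))
    where
    i≡0 : toℕ i ≡ 0
    i≡0 = trans (sym (Fin.toℕ-inject₁ i)) (cong toℕ (inj {inject₁ i} {zero} (trans eq (trans (cong c ss≡) closed))))

m≤2^m : ∀ m → m ≤ 2 ^ m
m≤2^m zero    = z≤n
m≤2^m (suc m) = begin
  suc m            ≤⟨ s≤s (m≤2^m m) ⟩
  1 + 2 ^ m        ≤⟨ ℕ.+-monoˡ-≤ (2 ^ m) (ℕ.m^n>0 2 m) ⟩
  2 ^ m + 2 ^ m    ≡⟨ cong (λ z → 2 ^ m + z) (ℕ.+-identityʳ (2 ^ m)) ⟨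
  2 ^ suc m        ∎
  where open ℕ.≤-Reasoning

module _ {n g k : ℕ} (A : Arrangement (Fin n) g k) where
  open Arrangement A

  worldLines : FiniteCollection (Point 3)
  worldLines = record
    { size     = n
    ; member   = λ i → worldLine (δ i) (β i)
    ; distinct = λ {i} {j} (⊆ , _) → β-injective
        (starts-equal {δ i} {β i} {δ j} {β j} (⊆ {at (δ i) (β i) 0ℚ} (at∈worldLine (δ i) (β i) 0ℚ)))
    }

  worldLines-lines : ∀ i → IsLine (member worldLines i)
  worldLines-lines i = origin (β i) , direction (δ i) , direction≉0 (δ i) , id , id

  private
    G = intersectionGraph worldLines
    open SimpleGraph G using (Adj)

    adj⇒meet : ∀ {i j} → Adj i j → Meet (δ i) (β i) (δ j) (β j)
    adj⇒meet {i} {j} (i≢j , common) = intersect⇒meet {δ i} {β i} {δ j} {β j} (i≢j ∘ β-injective) common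

    meet⇒adj : ∀ {i j} → Meet (δ i) (β i) (δ j) (β j) → Adj i j
    meet⇒adj {i} {j} m = (λ i≡j → proj₁ m (cong δ i≡j)) , meet⇒intersect {δ i} {β i} {δ j} {β j} m

    -- Intersection of the real lines is decided by the integer condition `Meet`.
    adj? : ∀ i j → Dec (Adj i j)
    adj? i j = map′ meet⇒adj adj⇒meet (¬? (δ i ≟² δ j) ×-dec ((β i ⊖ β j ∧ δ i ⊖ δ j) ℤ.≟ 0ℤ))

    hasCycle? : ∀ ℓ → Dec (HasCycle G ℓ)
    hasCycle? ℓ = (3 ℕ.≤? ℓ) ×-dec anyFunction?
      (λ c → map′ (λ inj {i} {j} → inj i j) (λ inj i j → inj {i} {j})
               (Fin.all? λ i → Fin.all? λ j → (c (inject₁ i) Fin.≟ c (inject₁ j)) →-dec (i Fin.≟ j))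
             ×-dec (c (fromℕ ℓ) Fin.≟ c zero)
             ×-dec Fin.all? λ i → adj? (c (inject₁ i)) (c (suc i)))
      (λ {c} {c′} eq (inj , closed , adj) →
        (λ {i} {j} e → inj (trans (eq _) (trans e (sym (eq _))))) ,
        trans (sym (eq _)) (trans closed (eq zero)) ,
        (λ i → subst₂ Adj (eq _) (eq _) (adj i)))

    colourable? : ∀ m → Dec (Colourable G m)
    colourable? m = map′ (λ (f , p) → f , λ {u} {v} → p u v) (λ (f , p) → f , λ u v → p {u} {v})
      (anyFunction? (λ f → Fin.all? λ u → Fin.all? λ v → adj? u v →-dec ¬? (f u Fin.≟ f v))
        (λ eq p u v a e → p u v a (trans (eq u) (trans e (sym (eq v))))))

    between : ∀ {a b c} e → Incident a e → Incident b e → Incident c e → a ≢ b → b ≢ c → a ≡ c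
    between e (inj₁ refl) (inj₁ refl) _           a≢b b≢c = contradiction refl a≢b
    between e (inj₁ refl) (inj₂ refl) (inj₁ refl) a≢b b≢c = refl
    between e (inj₁ refl) (inj₂ refl) (inj₂ refl) a≢b b≢c = contradiction refl b≢c
    between e (inj₂ refl) (inj₁ refl) (inj₁ refl) a≢b b≢c = contradiction refl b≢c
    between e (inj₂ refl) (inj₁ refl) (inj₂ refl) a≢b b≢c = refl
    between e (inj₂ refl) (inj₂ refl) _           a≢b b≢c = contradiction refl a≢b

    -- A cycle is a walk without backtracking: if two consecutive edges were equal, this edge would
    -- contain three consecutive vertices, and the outer two would coincide.
    cycle-length : ∀ {ℓ} → HasCycle G ℓ → g ≤ ℓ
    cycle-length {suc m} (s≤s 2≤m , c , inj , closed , adj) =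
      girth (subst (λ v → Walk Incident (c zero) (proj₁ (edge (fromℕ m))) v (suc m)) closed
        (toWalk m c (proj₁ ∘ edge) (proj₁ ∘ proj₂ ∘ edge) (proj₂ ∘ proj₂ ∘ edge) (proj₁ ∘ adj)
          λ i e≡ → cycle-no-return 2≤m c inj closed i
            (between (proj₁ (edge (suc i)))
              (subst (Incident _) e≡ (proj₁ (proj₂ (edge (inject₁ i)))))
              (proj₁ (proj₂ (edge (suc i)))) (proj₂ (proj₂ (edge (suc i))))
              (proj₁ (adj (inject₁ i))) (proj₁ (adj (suc i))))))
      where
      edge : ∀ i → ∃[ e ] (Incident (c (inject₁ i)) e × Incident (c (suc i)) e)
      edge i = meet⇒edge (adj⇒meet (adj i))

  worldLines-girth : ∃[ γ ] (IsGirth G γ × [ g ] ≤⁺ γ)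
  -- The vertices of a cycle are distinct, so its length is less than `suc n`.
  worldLines-girth with leastBelow hasCycle? (suc n)
  ... | inj₁ (ℓ , cycle , minimal) = [ ℓ ] , (cycle , minimal) , _≤⁺_.[_] (cycle-length cycle)
  ... | inj₂ none = ⊤⁺ , (λ ℓ (3≤ℓ , c , inj , rest) →
          none ℓ (s≤s (Fin.injective⇒≤ {f = c ∘ inject₁} inj)) (3≤ℓ , c , inj , rest)) , _≤⁺_._≤⊤⁺ [ g ]

  worldLines-chromatic : ∃[ χ ] (IsChromaticNumber G χ × k ≤ χ)
  -- Giving every line its own colour is a proper colouring with `n` colours, which bounds the
  -- search.
  worldLines-chromatic with least colourable? {n} (id , proj₁)
  ... | χ , (f , proper) , minimal = χ , ((f , proper) , minimal) , ℕ.≮⇒≥ absurd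
    where
    absurd : ¬ χ < k
    absurd χ<k with uncolourable (λ i → Fin.inject≤ (f i) (ℕ.<⇒≤ χ<k))
    ... | e , eq = proper (meet⇒adj (edge⇒meet e)) (Fin.inject≤-injective _ _ _ _ eq)

theorem2 : ∀ (g k : ℕ) → 3 ≤ g → 1 ≤ k →
    Σ[ S ∈ FiniteCollection (Point 3) ]
    ( (∀ i → IsLine (member S i))
    × (∃[ γ ] (IsGirth (intersectionGraph S) γ × [ g ] ≤⁺ γ))
    × (∃[ χ ] (IsChromaticNumber (intersectionGraph S) χ × k ≤ χ)) )
-- The exponent `g` gives girth at least `2 ^ g`, and `g ≤ 2 ^ g`.
theorem2 g k _ _ with arrangement g k
... | n , A = worldLines A , worldLines-lines A , weaken (worldLines-girth A) , worldLines-chromatic A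
  where
  weaken : ∀ {P : ℕ ⁺ → Set} → ∃[ γ ] (P γ × [ 2 ^ g ] ≤⁺ γ) → ∃[ γ ] (P γ × [ g ] ≤⁺ γ)
  weaken ([ ℓ ] , p , _≤⁺_.[_] le)      = [ ℓ ] , p , _≤⁺_.[_] (ℕ.≤-trans (m≤2^m g) le)
  weaken (⊤⁺    , p , _≤⁺_._≤⊤⁺ _) = ⊤⁺ , p , _≤⁺_._≤⊤⁺ [ g ]
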